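{- There is a polynomial time $2$-approximation algorithm for SM2-multi with a monotone submodular objective function (with no round-up assumption on the constraints). That is, there is an algorithm that, given any SM2-multi problem $\min f(X)$ subject to $a_{ij}x_i+b_{ij}x_j\ge c_{ij}$ for $(i,j)\in A$, $0\le x_j\le u_j$, $x_j$ integer for $j\in V$, that has a feasible integer solution and whose objective $f$ is nonnegative, submodular and monotone, outputs, in time polynomial in $|V|$, $|A|$ and $U=\max_j u_j$, a feasible solution $X$ with $f(X)\le 2f(S^*)$, where $S^*$ is an optimal solution.
   Context: Multi-sets: $V=\{1,\dots,n\}$ is a finite set and $\mathbf{u}=(u_j)_{j\in V}$ a vector of positive integers. An integer vector $\mathbf{x}$ with $0\le x_j\le u_j$ is the characteristic vector of the multi-set $X$ containing element $j$ exactly $x_j$ times. Containment, union and intersection are coordinatewise $\le$, maximum and minimum of characteristic vectors. A nonnegative real function $f$ on these multi-sets is submodular if $f(X)+f(Y)\ge f(X\cap Y)+f(X\cup Y)$ for all $X,Y$, and monotone if $f(S)\le f(T)$ whenever $S\subseteq T$. (If all $u_j=1$, these are ordinary subsets and the problem is called SM2.) In SM2-multi, $a_{ij},b_{ij},c_{ij}$ are real, $\mathbf{x}$ is the characteristic vector of $X$, and $A$ is a finite collection of pairs (singletons, i.e. one-variable constraints, and repeated pairs are allowed). As is standard in submodular minimization, $f$ is accessed through an evaluation (value) oracle, and running time counts oracle calls and elementary arithmetic operations. -}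

module Defs where

open import Level using (Level; _⊔_) renaming (suc to lsuc)
open import Algebra.Bundles using (CommutativeRing)
open import Algebra.Structures using (IsCommutativeRing)
import Algebra.Definitions.RawMonoid as RawMonoid
open import Data.Bool.Base using (Bool; if_then_else_)
open import Data.Fin.Base using (Fin; toℕ)
open import Data.List.Base using (List; []; _∷_; map)
open import Data.List.Membership.Propositional using (_∈_)
open import Data.List.Relation.Unary.All as All using (All; []; _∷_)
open import Data.Nat.Base as ℕ using (ℕ; zero; suc)
import Data.Nat.Properties as ℕ
open import Data.Product.Base using (Σ-syntax; ∃; _×_; _,_; proj₁; proj₂)
open import Data.Vec.Base as Vec using (Vec; []; _∷_; lookup; zipWith; toList)
open import Data.Vec.Relation.Binary.Pointwise.Inductive as Pointwise
  using (Pointwise; []; _∷_)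
open import Relation.Binary.Core using (Rel)
open import Relation.Binary.PropositionalEquality using (_≡_)
open import Relation.Binary.Structures using (IsDecTotalOrder)
open import Relation.Nullary.Decidable using (does)
open import Relation.Nullary.Negation using (¬_)

-- Archimedean ordered fields are, up to isomorphism, the ordered subfields of
-- the real numbers, ℝ being the largest one.  The order is decidable because
-- comparing two numbers is one of the elementary operations of the real RAM
-- model.  The inverse is a total operation whose value at 0# is unspecified.
record RealField (c ℓ₁ ℓ₂ : Level) : Set (lsuc (c ⊔ ℓ₁ ⊔ ℓ₂)) where
  infix  8 -_ _⁻¹
  infixl 7 _*_
  infixl 6 _+_
  infix  4 _≈_ _≤_
  field
    Carrier           : Set c
    _≈_               : Rel Carrier ℓ₁
    _≤_               : Rel Carrier ℓ₂
    _+_ _*_           : Carrier → Carrier → Carrier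
    -_ _⁻¹            : Carrier → Carrier
    0# 1#             : Carrier
    isCommutativeRing : IsCommutativeRing _≈_ _+_ _*_ -_ 0# 1#
    isDecTotalOrder   : IsDecTotalOrder _≈_ _≤_
    0≉1               : ¬ (0# ≈ 1#)
    ⁻¹-cong           : ∀ {x y} → x ≈ y → x ⁻¹ ≈ y ⁻¹
    *-inverseʳ        : ∀ x → ¬ (x ≈ 0#) → x * x ⁻¹ ≈ 1#
    +-monoˡ-≤         : ∀ z {x y} → x ≤ y → x + z ≤ y + z
    *-nonneg          : ∀ {x y} → 0# ≤ x → 0# ≤ y → 0# ≤ x * y

  commutativeRing : CommutativeRing c ℓ₁
  commutativeRing = record { isCommutativeRing = isCommutativeRing }

  open IsDecTotalOrder isDecTotalOrder public using (_≤?_)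
  open RawMonoid (CommutativeRing.+-rawMonoid commutativeRing) public
    using () renaming (_×_ to _·_)

  fromℕ : ℕ → Carrier
  fromℕ n = n · 1#

  field
    archimedean : ∀ x → ∃ λ n → x ≤ fromℕ n

private
  variable
    n : ℕ
    w : Vec ℕ n

record MultiSet {n : ℕ} (u : Vec ℕ n) : Set where
  constructor mkMultiSet
  field
    mult     : Vec ℕ n
    .bounded : Pointwise ℕ._≤_ mult u

open MultiSet public using (mult)

infix  4 _⊆_
infixr 7 _∩_
infixr 6 _∪_

_⊆_ : MultiSet w → MultiSet w → Set
X ⊆ Y = Pointwise ℕ._≤_ (mult X) (mult Y)

⊓-bounded : ∀ {n} {x y u : Vec ℕ n} → Pointwise ℕ._≤_ y u →
            Pointwise ℕ._≤_ (zipWith ℕ._⊓_ x y) u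
⊓-bounded {x = []}    []       = []
⊓-bounded {x = a ∷ _} (p ∷ ps) = ℕ.≤-trans (ℕ.m⊓n≤n a _) p ∷ ⊓-bounded ps

⊔-bounded : ∀ {n} {x y u : Vec ℕ n} → Pointwise ℕ._≤_ x u →
            Pointwise ℕ._≤_ y u → Pointwise ℕ._≤_ (zipWith ℕ._⊔_ x y) u
⊔-bounded []       []       = []
⊔-bounded (p ∷ ps) (q ∷ qs) = ℕ.⊔-lub p q ∷ ⊔-bounded ps qs

_∩_ : MultiSet w → MultiSet w → MultiSet w
mkMultiSet x _ ∩ mkMultiSet y y≤u =
  mkMultiSet (zipWith ℕ._⊓_ x y) (⊓-bounded y≤u)

_∪_ : MultiSet w → MultiSet w → MultiSet w
mkMultiSet x x≤u ∪ mkMultiSet y y≤u =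
  mkMultiSet (zipWith ℕ._⊔_ x y) (⊔-bounded x≤u y≤u)

-- Every list of naturals is a legal oracle query: it is truncated or padded
-- with zeros to length n, and every entry is cut off at its upper bound.  The
-- list of entries of a multi-set denotes that multi-set.
pad : ∀ n → List ℕ → Vec ℕ n
pad zero    _        = []
pad (suc n) []       = 0 ∷ pad n []
pad (suc n) (x ∷ xs) = x ∷ pad n xs

query : (u : Vec ℕ n) → List ℕ → MultiSet u
query {n} u xs =
  mkMultiSet (zipWith ℕ._⊓_ (pad n xs) u) (⊓-bounded (Pointwise.refl ℕ.≤-refl))

module Problem {c ℓ₁ ℓ₂ : Level} (ℝ : RealField c ℓ₁ ℓ₂) where
  open RealField ℝ

  -- a xᵢ + b xⱼ ≥ c.  The case i = j is allowed, and gives the constraints on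
  -- a single variable.
  record Constraint (n : ℕ) : Set c where
    field
      i j         : Fin n
      aᵢⱼ bᵢⱼ cᵢⱼ : Carrier

  Satisfies : {u : Vec ℕ n} → MultiSet u → Constraint n → Set ℓ₂
  Satisfies X C =
    cᵢⱼ ≤ aᵢⱼ * fromℕ (lookup (mult X) i) + bᵢⱼ * fromℕ (lookup (mult X) j)
    where open Constraint C

  record SM2Multi (n : ℕ) : Set c where
    field
      u        : Vec ℕ n
      positive : ∀ j → 1 ℕ.≤ lookup u j
      A        : List (Constraint n)
      f        : MultiSet u → Carrier

    U : ℕ
    U = Vec.foldr′ ℕ._⊔_ 0 u

    Feasible : MultiSet u → Set (c ⊔ ℓ₂)
    Feasible X = All (Satisfies X) A

    Optimal : MultiSet u → Set (c ⊔ ℓ₂)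
    Optimal S = Feasible S × (∀ X → Feasible X → f S ≤ f X)

  module _ {u : Vec ℕ n} (f : MultiSet u → Carrier) where

    Nonnegative : Set ℓ₂
    Nonnegative = ∀ X → 0# ≤ f X

    Submodular : Set ℓ₂
    Submodular = ∀ X Y → f (X ∩ Y) + f (X ∪ Y) ≤ f X + f Y

    Monotone : Set ℓ₂
    Monotone = ∀ S T → S ⊆ T → f S ≤ f T

-- Algorithms are programs of a first-order, call-by-value functional language
-- with naturals, Booleans, real numbers, pairs and lists, whose only loops are
-- primitive recursion over naturals and lists.  Real numbers are accessible
-- through the primitive operations only, and count as having unit size.  There
-- is no multiplication of naturals and there are no function types, so that
-- data of superpolynomial size cannot be built in polynomially many steps.

infixr 7 _⊗_

data Ty : Set where
  nat bool real : Ty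
  _⊗_           : Ty → Ty → Ty
  list          : Ty → Ty

private
  variable
    Γ   : List Ty
    σ τ : Ty

-- `oracle` evaluates the objective function.
data Prim : Ty → Ty → Set where
  addℕ monusℕ : Prim (nat ⊗ nat) nat
  leqℕ        : Prim (nat ⊗ nat) bool
  natToReal   : Prim nat real
  addℝ mulℝ   : Prim (real ⊗ real) real
  negℝ invℝ   : Prim real real
  leqℝ        : Prim (real ⊗ real) bool
  oracle      : Prim (list nat) real
  fst         : Prim (σ ⊗ τ) σ
  snd         : Prim (σ ⊗ τ) τ
  cons        : Prim (σ ⊗ list σ) (list σ)

infix 3 _⊢_

data _⊢_ : List Ty → Ty → Set where
  var     : σ ∈ Γ → Γ ⊢ σ
  let′    : Γ ⊢ σ → σ ∷ Γ ⊢ τ → Γ ⊢ τ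
  call    : σ ∷ [] ⊢ τ → Γ ⊢ σ → Γ ⊢ τ
  natLit  : ℕ → Γ ⊢ nat
  boolLit : Bool → Γ ⊢ bool
  nil     : Γ ⊢ list σ
  pair    : Γ ⊢ σ → Γ ⊢ τ → Γ ⊢ σ ⊗ τ
  prim    : Prim σ τ → Γ ⊢ σ → Γ ⊢ τ
  if      : Γ ⊢ bool → Γ ⊢ τ → Γ ⊢ τ → Γ ⊢ τ
  -- The step term has access to the predecessor (the head and the tail) and
  -- to the result of the recursive call, in this order.
  recℕ    : Γ ⊢ nat → Γ ⊢ τ → nat ∷ τ ∷ Γ ⊢ τ → Γ ⊢ τ
  recList : Γ ⊢ list σ → Γ ⊢ τ → σ ∷ list σ ∷ τ ∷ Γ ⊢ τ → Γ ⊢ τ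

-- A value together with the time needed to compute it.
Timed : ∀ {a} → Set a → Set a
Timed A = A × ℕ

module _ {a b : Level} {A : Set a} {B : Set b} where

  infixl 1 _>>=_

  _>>=_ : Timed A → (A → Timed B) → Timed B
  m >>= k = proj₁ (k (proj₁ m)) , proj₂ m ℕ.+ proj₂ (k (proj₁ m))

module _ {a : Level} {A : Set a} where

  return : A → Timed A
  return x = x , 0

  tick : Timed A → Timed A
  tick m = proj₁ m , suc (proj₂ m)

module _ {b : Level} {B : Set b} where

  iterℕ : Timed B → (ℕ → B → Timed B) → ℕ → Timed B
  iterℕ z s zero    = z
  iterℕ z s (suc m) = iterℕ z s m >>= λ r → s m r

  iterList : ∀ {a} {A : Set a} →
             Timed B → (A → List A → B → Timed B) → List A → Timed B
  iterList z s []       = z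
  iterList z s (x ∷ xs) = iterList z s xs >>= λ r → s x xs r

module Semantics {c ℓ₁ ℓ₂ : Level} (ℝ : RealField c ℓ₁ ℓ₂) where
  open RealField ℝ
  open Problem ℝ
  open import Level using (Lift; lift; lower)

  Val : Ty → Set c
  Val nat     = Lift c ℕ
  Val bool    = Lift c Bool
  Val real    = Carrier
  Val (σ ⊗ τ) = Val σ × Val τ
  Val (list σ) = List (Val σ)

  Env : List Ty → Set c
  Env = All Val

  module _ (value : List ℕ → Carrier) where

    applyPrim : Prim σ τ → Val σ → Val τ
    applyPrim addℕ      (lift x , lift y) = lift (x ℕ.+ y)
    applyPrim monusℕ    (lift x , lift y) = lift (x ℕ.∸ y)
    applyPrim leqℕ      (lift x , lift y) = lift (x ℕ.≤ᵇ y)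
    applyPrim natToReal (lift x)          = fromℕ x
    applyPrim addℝ      (x , y)           = x + y
    applyPrim mulℝ      (x , y)           = x * y
    applyPrim negℝ      x                 = - x
    applyPrim invℝ      x                 = x ⁻¹
    applyPrim leqℝ      (x , y)           = lift (does (x ≤? y))
    applyPrim oracle    xs                = value (map lower xs)
    applyPrim fst       (x , _)           = x
    applyPrim snd       (_ , y)           = y
    applyPrim cons      (x , xs)          = x ∷ xs

    -- Every evaluation of a subterm takes one unit of time in addition to the
    -- evaluations it triggers; the body of a loop is charged every time it is
    -- executed.
    mutual
      eval : Γ ⊢ τ → Env Γ → Timed (Val τ)
      eval t γ = tick (step t γ)

      step : Γ ⊢ τ → Env Γ → Timed (Val τ)
      step (var x)         γ = return (All.lookup γ x)
      step (let′ t b)      γ = eval t γ >>= λ x → eval b (x ∷ γ)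
      step (call b t)      γ = eval t γ >>= λ x → eval b (x ∷ [])
      step (natLit m)      γ = return (lift m)
      step (boolLit b)     γ = return (lift b)
      step nil             γ = return []
      step (pair s t)      γ = eval s γ >>= λ x → eval t γ >>= λ y → return (x , y)
      step (prim p t)      γ = eval t γ >>= λ x → return (applyPrim p x)
      step (if b s t)      γ = eval b γ >>= λ x →
                               if lower x then eval s γ else eval t γ
      step (recℕ t z s)    γ = eval t γ >>= λ m →
        iterℕ (eval z γ) (λ k r → eval s (lift k ∷ r ∷ γ)) (lower m)
      step (recList t z s) γ = eval t γ >>= λ xs →
        iterList (eval z γ) (λ x xs′ r → eval s (x ∷ xs′ ∷ r ∷ γ)) xs

  -- The input of an algorithm for SM2-multi consists of the upper bounds and
  -- the constraints (i, j, aᵢⱼ, bᵢⱼ, cᵢⱼ); the objective function is given by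
  -- its value oracle.  Variables are numbered from 0.
  InputTy : Ty
  InputTy = list nat ⊗ list (nat ⊗ nat ⊗ real ⊗ real ⊗ real)

  Algorithm : Set
  Algorithm = InputTy ∷ [] ⊢ list nat

  module _ {n : ℕ} (alg : Algorithm) (P : SM2Multi n) where
    open SM2Multi P

    input : Val InputTy
    input = map lift (toList u) , map encode A
      where
      encode : Constraint n → Val (nat ⊗ nat ⊗ real ⊗ real ⊗ real)
      encode C = lift (toℕ i) , lift (toℕ j) , aᵢⱼ , bᵢⱼ , cᵢⱼ
        where open Constraint C

    run : Timed (List (Lift c ℕ))
    run = eval (λ xs → f (query u xs)) alg (input ∷ [])

    output : List ℕ
    output = map lower (proj₁ run)

    time : ℕ
    time = proj₂ run

{-# OPTIONS --safe #-}
module Submission where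

-- The condition xᵢ > p is a literal.  Since a constraint involves two
-- variables only, the feasible points are closed under componentwise medians.
-- Hence a multi-set that satisfies all implied clauses (xᵢ > p or xⱼ > q)
-- contains a feasible point, and by monotonicity it is enough to find a cheap
-- multi-set satisfying these clauses.  Whether a box contains a feasible point
-- is decided by tightening bounds: clamping any feasible point to a box whose
-- bounds are stable yields a feasible point.
--
-- A cheap multi-set is found by derandomising Pitt's algorithm for vertex
-- cover, without submodular minimisation.  A probability distribution on
-- multi-sets is kept, given by weights.  For every implied clause each set is
-- raised to satisfy one of the two literals, one set being divided so that the
-- expected increases of f caused by the two literals agree.  Let S be feasible.
-- Raising X at a literal that S satisfies lowers 2 f(X ∪ S) − f(X) by the
-- increase of f(X), and raising it at the other one adds at most the increase of
-- f(X), by submodularity.  So the expectation of 2 f(X ∪ S) − f(X) never grows.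
-- It is at most 2 f(S) initially, and always at least the expectation of f(X).

open import Defs
open import Algebra.Bundles using (CommutativeRing)
import Algebra.Properties.Ring as RingProperties
import Algebra.Properties.Semiring.Mult as SemiringMult
import Algebra.Solver.Ring as RingSolver
open import Algebra.Solver.Ring.AlmostCommutativeRing
  using (fromCommutativeRing; _-Raw-AlmostCommutative⟶_)
open import Data.Bool.Base using (true; false; if_then_else_)
open import Data.Empty using (⊥)
open import Data.Fin.Base as Fin using (Fin; toℕ)
open import Data.Fin.Patterns using (0F; 1F; 2F)
import Data.Fin.Properties as Fin
open import Data.Integer.Base as ℤ using (ℤ; +_; -[1+_]; _⊖_; _◃_)
import Data.Integer.Properties as ℤ
open import Data.List.Base using (List; []; _∷_; map; length; allFin; drop; head; tabulate)
open import Data.List.Membership.Propositional using (_∈_)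
open import Data.List.Membership.Propositional.Properties using (∈-allFin)
import Data.List.Properties as List
open import Data.List.Relation.Unary.All as All using (All; []; _∷_)
open import Data.List.Relation.Unary.Any using (here; there)
open import Data.Maybe.Base using (Maybe; just; nothing)
open import Data.Nat.Base as ℕ using (ℕ; zero; suc; z≤n; s≤s; _∸_; pred)
open import Data.Nat.ListAction using (sum)
import Data.Nat.Properties as ℕ
open import Data.Nat.Solver using (module +-*-Solver)
open import Data.Product.Base using (∃; ∃₂; Σ-syntax; _×_; _,_; proj₁; proj₂)
import Data.Sign.Base as Sign
open import Data.Sum.Base using (_⊎_; inj₁; inj₂)
open import Data.Unit.Base using (⊤; tt)
open import Data.Vec.Base as Vec using (Vec; []; _∷_; lookup; toList)
open import Data.Vec.Functional using (updateAt)
open import Data.Vec.Functional.Properties using (updateAt-updates; updateAt-minimal)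
import Data.Vec.Properties as Vec
open import Data.Vec.Relation.Binary.Pointwise.Inductive as Pointwise using (Pointwise; []; _∷_)
open import Function.Base using (const; _∘_; case_of_)
open import Level using (Level; Lift; lift; lower; _⊔_)
open import Relation.Binary.PropositionalEquality
  using (_≡_; _≗_; _≢_; refl; sym; trans; cong; cong₂; subst; subst₂)
import Relation.Binary.Reasoning.Setoid as SetoidReasoning
open import Relation.Binary.Structures using (IsDecTotalOrder)
open import Relation.Nullary.Decidable
  using (Dec; yes; no; does; _because_; dec-true; dec-false; _⊎-dec_; _×-dec_; map′; recompute)
open import Relation.Nullary.Negation using (¬_; contradiction)
open import Relation.Nullary.Reflects using (Reflects; ofʸ; ofⁿ)

-- The algorithm cannot know which literal of an implied clause a given feasible `S` satisfies.
-- Equating the two expected increases makes this irrelevant: whatever the wrong literal may add to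
-- the expected potential, the right one takes away. Since one and the same division of the family
-- serves every feasible `S`, nothing about an optimal solution has to be computed. The coefficient
-- 2 is forced from both sides in this argument. For `c f(X ∪ S) − f(X)` the wrong literal adds up
-- to `c − 1` times the increase of `f(X)`, so cancellation asks for `c ≤ 2`; the final comparison
-- with `f(X)`, already for `X = S`, asks for `c ≥ 2`. Independent coin tosses would double the
-- support with every clause. Dividing a single set adds at most one member per clause. There is one
-- literal for each unit of each `u_j`, and the clauses are pairs of literals, so the support stays
-- polynomial in n and U. The multi-set that is found need not be feasible. It is lowered to a
-- feasible point below it, where monotonicity keeps the value; this replaces rounding up.

private
  variable
    n   : ℕ
    Γ   : List Ty
    σ τ : Ty
    q r : Level

-- Ordered fields

module IntegerCoefficients {c ℓ} (R : CommutativeRing c ℓ) where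
  open CommutativeRing R renaming (refl to ≈-refl; sym to ≈-sym; trans to ≈-trans)
  open RingProperties ring
  open SemiringMult semiring using (×-homo-+; ×1-homo-*) renaming (_×_ to _·_)
  open import Relation.Binary.Reasoning.Setoid setoid

  -- The ring solver cancels terms only where equality of coefficients can be decided by evaluation.
  -- In an abstract ring it cannot, whereas closed integers always evaluate.
  fromℤ : ℤ → Carrier
  fromℤ (+ n)    = n · 1#
  fromℤ -[1+ n ] = - (suc n · 1#)

  fromℤ-neg : ∀ n → fromℤ (ℤ.- (+ n)) ≈ - (n · 1#)
  fromℤ-neg zero    = ≈-sym -0#≈0#
  fromℤ-neg (suc n) = ≈-refl

  fromℤ-⊖ : ∀ m n → fromℤ (m ⊖ n) ≈ m · 1# - n · 1#
  fromℤ-⊖ m zero = begin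
    m · 1#        ≈⟨ +-identityʳ _ ⟨
    m · 1# + 0#   ≈⟨ +-congˡ -0#≈0# ⟨
    m · 1# - 0#   ∎
  fromℤ-⊖ zero (suc n) = ≈-sym (+-identityˡ _)
  fromℤ-⊖ (suc m) (suc n) = begin
    fromℤ (suc m ⊖ suc n)              ≡⟨ cong fromℤ (ℤ.[1+m]⊖[1+n]≡m⊖n m n) ⟩
    fromℤ (m ⊖ n)                      ≈⟨ fromℤ-⊖ m n ⟩
    m · 1# - n · 1#                    ≈⟨ +-congʳ (+-identityˡ _) ⟨
    0# + m · 1# - n · 1#               ≈⟨ +-congʳ (+-congʳ (-‿inverseʳ 1#)) ⟨
    1# - 1# + m · 1# - n · 1#          ≈⟨ +-congʳ (+-assoc _ _ _) ⟩
    1# + (- 1# + m · 1#) - n · 1#      ≈⟨ +-congʳ (+-congˡ (+-comm _ _)) ⟩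
    1# + (m · 1# - 1#) - n · 1#        ≈⟨ +-congʳ (+-assoc _ _ _) ⟨
    1# + m · 1# - 1# - n · 1#          ≈⟨ +-assoc _ _ _ ⟩
    1# + m · 1# + (- 1# - n · 1#)      ≈⟨ +-congˡ (-‿+-comm _ _) ⟩
    1# + m · 1# - (1# + n · 1#)        ∎

  fromℤ-+ : ∀ x y → fromℤ (x ℤ.+ y) ≈ fromℤ x + fromℤ y
  fromℤ-+ (+ m)    (+ n)    = ×-homo-+ 1# m n
  fromℤ-+ (+ m)    -[1+ n ] = fromℤ-⊖ m (suc n)
  fromℤ-+ -[1+ m ] (+ n)    = ≈-trans (fromℤ-⊖ n (suc m)) (+-comm _ _)
  fromℤ-+ -[1+ m ] -[1+ n ] = begin
    - (suc (suc (m ℕ.+ n)) · 1#)       ≡⟨ cong (λ k → - (suc k · 1#)) (ℕ.+-suc m n) ⟨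
    - ((suc m ℕ.+ suc n) · 1#)         ≈⟨ -‿cong (×-homo-+ 1# (suc m) (suc n)) ⟩
    - (suc m · 1# + suc n · 1#)        ≈⟨ -‿+-comm _ _ ⟨
    - (suc m · 1#) - suc n · 1#        ∎

  fromℤ-* : ∀ x y → fromℤ (x ℤ.* y) ≈ fromℤ x * fromℤ y
  fromℤ-* (+ m) (+ n) = begin
    fromℤ (Sign.+ ◃ m ℕ.* n)   ≡⟨ cong fromℤ (ℤ.+◃n≡+n (m ℕ.* n)) ⟩
    (m ℕ.* n) · 1#             ≈⟨ ×1-homo-* m n ⟩
    m · 1# * n · 1#            ∎
  fromℤ-* (+ m) -[1+ n ] = begin
    fromℤ (Sign.- ◃ m ℕ.* suc n)   ≡⟨ cong fromℤ (ℤ.-◃n≡-n (m ℕ.* suc n)) ⟩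
    fromℤ (ℤ.- (+ (m ℕ.* suc n)))  ≈⟨ fromℤ-neg (m ℕ.* suc n) ⟩
    - ((m ℕ.* suc n) · 1#)         ≈⟨ -‿cong (×1-homo-* m (suc n)) ⟩
    - (m · 1# * suc n · 1#)        ≈⟨ -‿distribʳ-* _ _ ⟩
    m · 1# * - (suc n · 1#)        ∎
  fromℤ-* -[1+ m ] (+ n) = begin
    fromℤ (Sign.- ◃ suc m ℕ.* n)   ≡⟨ cong fromℤ (ℤ.-◃n≡-n (suc m ℕ.* n)) ⟩
    fromℤ (ℤ.- (+ (suc m ℕ.* n)))  ≈⟨ fromℤ-neg (suc m ℕ.* n) ⟩
    - ((suc m ℕ.* n) · 1#)         ≈⟨ -‿cong (×1-homo-* (suc m) n) ⟩
    - (suc m · 1# * n · 1#)        ≈⟨ -‿distribˡ-* _ _ ⟩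
    - (suc m · 1#) * n · 1#        ∎
  fromℤ-* -[1+ m ] -[1+ n ] = begin
    (suc m ℕ.* suc n) · 1#               ≈⟨ ×1-homo-* (suc m) (suc n) ⟩
    suc m · 1# * suc n · 1#              ≈⟨ -‿involutive _ ⟨
    - - (suc m · 1# * suc n · 1#)        ≈⟨ -‿cong (-‿distribˡ-* _ _) ⟩
    - (- (suc m · 1#) * suc n · 1#)      ≈⟨ -‿distribʳ-* _ _ ⟩
    - (suc m · 1#) * - (suc n · 1#)      ∎

  fromℤ-‿- : ∀ x → fromℤ (ℤ.- x) ≈ - fromℤ x
  fromℤ-‿- (+ n)    = fromℤ-neg n
  fromℤ-‿- -[1+ n ] = ≈-sym (-‿involutive _)

  private
    morphism : ℤ.+-*-rawRing -Raw-AlmostCommutative⟶ fromCommutativeRing R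
    morphism = record
      { ⟦_⟧    = fromℤ
      ; +-homo = fromℤ-+
      ; *-homo = fromℤ-*
      ; -‿homo = fromℤ-‿-
      ; 0-homo = ≈-refl
      ; 1-homo = +-identityʳ 1#
      }

    weaklyDecide : ∀ x y → Maybe (fromℤ x ≈ fromℤ y)
    weaklyDecide x y with x ℤ.≟ y
    ... | yes refl = just ≈-refl
    ... | no  _      = nothing

  module Solver = RingSolver ℤ.+-*-rawRing (fromCommutativeRing R) morphism weaklyDecide

module OrderedField {c ℓ₁ ℓ₂} (ℝ : RealField c ℓ₁ ℓ₂) where
  open RealField ℝ
  open CommutativeRing commutativeRing public
    using (_-_; +-identityˡ; +-identityʳ; -‿inverseʳ; *-identityˡ; *-identityʳ;
           zeroˡ; zeroʳ; +-cong; +-congˡ; +-congʳ; *-cong; *-congˡ; *-congʳ; -‿cong; setoid)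
    renaming (refl to ≈-refl; sym to ≈-sym; trans to ≈-trans;
              +-comm to +-commutative)
  open IsDecTotalOrder isDecTotalOrder public
    using (≤-respˡ-≈; ≤-respʳ-≈)
    renaming (refl to ≤-refl; trans to ≤-trans; reflexive to ≤-reflexive; total to ≤-total;
              antisym to ≤-antisym)
  open IntegerCoefficients commutativeRing public using (module Solver)
  open Solver

  x≤y⇒0≤y-x : ∀ {x y} → x ≤ y → 0# ≤ y - x
  x≤y⇒0≤y-x {x} {y} x≤y = ≤-respˡ-≈ (-‿inverseʳ x) (+-monoˡ-≤ (- x) x≤y)

  ≈+nonneg⇒≤ : ∀ {x y z} → 0# ≤ z → y ≈ x + z → x ≤ y
  ≈+nonneg⇒≤ {x} {y} {z} 0≤z y≈x+z = ≤-respʳ-≈ (≈-sym y≈x+z)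
    (≤-respˡ-≈ (+-identityˡ x) (≤-respʳ-≈ (+-commutative z x) (+-monoˡ-≤ x 0≤z)))

  +-mono-≤ : ∀ {x y z w} → x ≤ y → z ≤ w → x + z ≤ y + w
  +-mono-≤ {x} {y} {z} {w} x≤y z≤w = ≤-trans (+-monoˡ-≤ z x≤y)
    (≤-respˡ-≈ (+-commutative z y) (≤-respʳ-≈ (+-commutative w y) (+-monoˡ-≤ y z≤w)))

  +-nonneg : ∀ {x y} → 0# ≤ x → 0# ≤ y → 0# ≤ x + y
  +-nonneg 0≤x 0≤y = ≤-respˡ-≈ (+-identityˡ 0#) (+-mono-≤ 0≤x 0≤y)

  -‿nonneg : ∀ {x} → x ≤ 0# → 0# ≤ - x
  -‿nonneg {x} x≤0 = ≤-respʳ-≈ (+-identityˡ (- x)) (x≤y⇒0≤y-x x≤0)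

  ≰⇒≥ : ∀ {x y} → ¬ x ≤ y → y ≤ x
  ≰⇒≥ {x} {y} x≰y with ≤-total x y
  ... | inj₁ x≤y = contradiction x≤y x≰y
  ... | inj₂ y≤x = y≤x

  *-monoˡ-≤ : ∀ {a x y} → 0# ≤ a → x ≤ y → a * x ≤ a * y
  *-monoˡ-≤ {a} {x} {y} 0≤a x≤y = ≈+nonneg⇒≤ (*-nonneg 0≤a (x≤y⇒0≤y-x x≤y))
    (solve 3 (λ a x y → a :* y := a :* x :+ a :* (y :- x)) ≈-refl a x y)

  *-antimonoˡ-≤ : ∀ {a x y} → a ≤ 0# → x ≤ y → a * y ≤ a * x
  *-antimonoˡ-≤ {a} {x} {y} a≤0 x≤y = ≈+nonneg⇒≤ (*-nonneg (-‿nonneg a≤0) (x≤y⇒0≤y-x x≤y))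
    (solve 3 (λ a x y → a :* x := a :* y :+ (:- a) :* (y :- x)) ≈-refl a x y)

  0≤1 : 0# ≤ 1#
  0≤1 with ≤-total 0# 1#
  ... | inj₁ 0≤1 = 0≤1
  ... | inj₂ 1≤0 = ≤-respʳ-≈ (≈-trans
    (solve 1 (λ x → (:- x) :* (:- x) := x :* x) ≈-refl 1#) (*-identityˡ 1#))
    (*-nonneg (-‿nonneg 1≤0) (-‿nonneg 1≤0))

  ⁻¹-nonneg : ∀ {x} → 0# ≤ x → ¬ x ≈ 0# → 0# ≤ x ⁻¹
  ⁻¹-nonneg {x} 0≤x x≉0 with ≤-total 0# (x ⁻¹)
  ... | inj₁ 0≤x⁻¹ = 0≤x⁻¹
  ... | inj₂ x⁻¹≤0 = contradiction (≤-antisym 0≤1 1≤0) 0≉1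
    where
    1≤0 : 1# ≤ 0#
    1≤0 = ≈+nonneg⇒≤ (*-nonneg 0≤x (-‿nonneg x⁻¹≤0)) (≈-trans
      (solve 2 (λ x y → con (+ 0) := x :* y :+ x :* (:- y)) ≈-refl x (x ⁻¹))
      (+-congʳ (*-inverseʳ x x≉0)))

  0≤fromℕ : ∀ n → 0# ≤ fromℕ n
  0≤fromℕ zero    = ≤-refl
  0≤fromℕ (suc n) = +-nonneg 0≤1 (0≤fromℕ n)

  fromℕ-mono-≤ : ∀ {m n} → m ℕ.≤ n → fromℕ m ≤ fromℕ n
  fromℕ-mono-≤ (z≤n {n}) = 0≤fromℕ n
  fromℕ-mono-≤ (s≤s m≤n) = +-mono-≤ ≤-refl (fromℕ-mono-≤ m≤n)

-- Medians and boxes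

-- A majority among three. Two majorities share an index, which turns separate statements about two
-- coordinates of a median into one about a single point.
data Two {p} (P : Fin 3 → Set p) : Set p where
  two₀₁ : P 0F → P 1F → Two P
  two₀₂ : P 0F → P 2F → Two P
  two₁₂ : P 1F → P 2F → Two P

two-map : ∀ {p q} {P : Fin 3 → Set p} {Q : Fin 3 → Set q} →
          (∀ {k} → P k → Q k) → Two P → Two Q
two-map f (two₀₁ p q) = two₀₁ (f p) (f q)
two-map f (two₀₂ p q) = two₀₂ (f p) (f q)
two-map f (two₁₂ p q) = two₁₂ (f p) (f q)

two-meet : ∀ {p q} {P : Fin 3 → Set p} {Q : Fin 3 → Set q} →
           Two P → Two Q → ∃ λ k → P k × Q k
two-meet (two₀₁ p _) (two₀₁ q _) = 0F , p , q
two-meet (two₀₁ p _) (two₀₂ q _) = 0F , p , q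
two-meet (two₀₁ _ p) (two₁₂ q _) = 1F , p , q
two-meet (two₀₂ p _) (two₀₁ q _) = 0F , p , q
two-meet (two₀₂ p _) (two₀₂ q _) = 0F , p , q
two-meet (two₀₂ _ p) (two₁₂ _ q) = 2F , p , q
two-meet (two₁₂ p _) (two₀₁ _ q) = 1F , p , q
two-meet (two₁₂ _ p) (two₀₂ _ q) = 2F , p , q
two-meet (two₁₂ p _) (two₁₂ q _) = 1F , p , q

record IsMedian (m : ℕ) (x : Fin 3 → ℕ) : Set where
  constructor isMedian
  field
    two-≤ : Two (λ k → x k ℕ.≤ m)
    two-≥ : Two (λ k → m ℕ.≤ x k)

median : (x : Fin 3 → ℕ) → ∃ λ m → IsMedian m x
median x with ℕ.≤-total (x 0F) (x 1F) | ℕ.≤-total (x 1F) (x 2F) | ℕ.≤-total (x 0F) (x 2F)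
... | inj₁ 0≤1 | inj₁ 1≤2 | _        = x 1F , isMedian (two₀₁ 0≤1 ℕ.≤-refl) (two₁₂ ℕ.≤-refl 1≤2)
... | inj₁ 0≤1 | inj₂ 2≤1 | inj₁ 0≤2 = x 2F , isMedian (two₀₂ 0≤2 ℕ.≤-refl) (two₁₂ 2≤1 ℕ.≤-refl)
... | inj₁ 0≤1 | inj₂ 2≤1 | inj₂ 2≤0 = x 0F , isMedian (two₀₂ ℕ.≤-refl 2≤0) (two₀₁ ℕ.≤-refl 0≤1)
... | inj₂ 1≤0 | inj₁ 1≤2 | inj₁ 0≤2 = x 0F , isMedian (two₀₁ ℕ.≤-refl 1≤0) (two₀₂ ℕ.≤-refl 0≤2)
... | inj₂ 1≤0 | inj₁ 1≤2 | inj₂ 2≤0 = x 2F , isMedian (two₁₂ 1≤2 ℕ.≤-refl) (two₀₂ 2≤0 ℕ.≤-refl)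
... | inj₂ 1≤0 | inj₂ 2≤1 | _        = x 1F , isMedian (two₁₂ ℕ.≤-refl 2≤1) (two₀₁ 1≤0 ℕ.≤-refl)

two-≤⇒median-≤ : ∀ {m b} {x : Fin 3 → ℕ} → IsMedian m x → Two (λ k → x k ℕ.≤ b) → m ℕ.≤ b
two-≤⇒median-≤ (isMedian _ m≤) x≤b with two-meet m≤ x≤b
... | _ , m≤x , x≤b = ℕ.≤-trans m≤x x≤b

sum-mono-≤ : ∀ {a} {A : Set a} {g h : A → ℕ} → (∀ x → g x ℕ.≤ h x) →
             ∀ xs → sum (map g xs) ℕ.≤ sum (map h xs)
sum-mono-≤ g≤h []       = z≤n
sum-mono-≤ g≤h (x ∷ xs) = ℕ.+-mono-≤ (g≤h x) (sum-mono-≤ g≤h xs)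

sum-mono-< : ∀ {a} {A : Set a} {g h : A → ℕ} → (∀ x → g x ℕ.≤ h x) →
             ∀ {x xs} → x ∈ xs → g x ℕ.< h x → sum (map g xs) ℕ.< sum (map h xs)
sum-mono-< g≤h {xs = _ ∷ xs} (here refl)  gx<hx = ℕ.+-mono-<-≤ gx<hx (sum-mono-≤ g≤h xs)
sum-mono-< g≤h               (there x∈xs) gx<hx = ℕ.+-mono-≤-< (g≤h _) (sum-mono-< g≤h x∈xs gx<hx)

Point : ℕ → Set
Point n = Fin n → ℕ

Box : ℕ → Set
Box n = Fin n → ℕ × ℕ

infix 4 _≤̇_
_≤̇_ : Point n → Point n → Set
s ≤̇ t = ∀ k → s k ℕ.≤ t k

lo hi : Box n → Point n
lo B k = proj₁ (B k)
hi B k = proj₂ (B k)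

fix : Box n → Fin n → ℕ → Box n
fix B k v = updateAt B k (const (v , v))

-- The case `l = k` is included because both variables of a constraint may coincide.
fix-other : ∀ (B : Box n) k {v} l → (v ≡ lo B k ⊎ v ≡ hi B k) →
  let B′ = fix B k v in
  (lo B′ l ≡ lo B l ⊎ lo B′ l ≡ hi B l) × (hi B′ l ≡ lo B l ⊎ hi B′ l ≡ hi B l)
fix-other B k {v} l v∈ with l Fin.≟ k
... | yes refl = subst (λ p → (proj₁ p ≡ lo B k ⊎ proj₁ p ≡ hi B k) × (proj₂ p ≡ lo B k ⊎ proj₂ p ≡ hi B k))
                       (sym (updateAt-updates k B)) (v∈ , v∈)
... | no  l≢k  = inj₁ (cong proj₁ (updateAt-minimal l k B l≢k)) ,
                 inj₂ (cong proj₂ (updateAt-minimal l k B l≢k))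

infix 4 _∈ᵇ_
_∈ᵇ_ : Point n → Box n → Set
s ∈ᵇ B = lo B ≤̇ s × s ≤̇ hi B

∈ᵇ-fix : ∀ {s : Point n} {B k} → s ∈ᵇ B → s ∈ᵇ fix B k (s k)
∈ᵇ-fix {s = s} {B} {k} (lo≤s , s≤hi) = proj₁ ∘ go , proj₂ ∘ go
  where
  go : ∀ l → lo (fix B k (s k)) l ℕ.≤ s l × s l ℕ.≤ hi (fix B k (s k)) l
  go l with l Fin.≟ k
  ... | yes refl = subst (λ p → proj₁ p ℕ.≤ s k × s k ℕ.≤ proj₂ p)
                         (sym (updateAt-updates k B)) (ℕ.≤-refl , ℕ.≤-refl)
  ... | no  l≢k  = subst (λ p → proj₁ p ℕ.≤ s l × s l ℕ.≤ proj₂ p)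
                         (sym (updateAt-minimal l k B l≢k)) (lo≤s l , s≤hi l)

updateAt-cong : ∀ {A : Set} {B B′ : Fin n → A} k {f : A → A} →
                B ≗ B′ → updateAt B k f ≗ updateAt B′ k f
updateAt-cong {B = B} {B′} k {f} B≗B′ l with l Fin.≟ k
... | yes refl = trans (updateAt-updates k B) (trans (cong f (B≗B′ k)) (sym (updateAt-updates k B′)))
... | no  l≢k  = trans (updateAt-minimal l k B l≢k) (trans (B≗B′ l) (sym (updateAt-minimal l k B′ l≢k)))

-- Closure of the feasible points under medians.

module TwoVariableConstraints {c ℓ₁ ℓ₂} (ℝ : RealField c ℓ₁ ℓ₂) {n : ℕ}
                              (A : List (Problem.Constraint ℝ n)) where
  open RealField ℝ
  open OrderedField ℝ
  open Problem ℝ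
  open Constraint

  At : Constraint n → ℕ → ℕ → Set ℓ₂
  At C x y = cᵢⱼ C ≤ aᵢⱼ C * fromℕ x + bᵢⱼ C * fromℕ y

  Sat : Point n → Constraint n → Set ℓ₂
  Sat s C = At C (s (i C)) (s (j C))

  Feas : Point n → Set _
  Feas s = All (Sat s) A

  two-scale : ∀ {m} {x : Fin 3 → ℕ} (a : Carrier) → IsMedian m x →
              Two (λ k → a * fromℕ (x k) ≤ a * fromℕ m)
  two-scale a (isMedian x≤m m≤x) with ≤-total 0# a
  ... | inj₁ 0≤a = two-map (*-monoˡ-≤ 0≤a ∘ fromℕ-mono-≤) x≤m
  ... | inj₂ a≤0 = two-map (*-antimonoˡ-≤ a≤0 ∘ fromℕ-mono-≤) m≤x

  At-mono : ∀ C x {x′} y {y′} → aᵢⱼ C * fromℕ x ≤ aᵢⱼ C * fromℕ x′ →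
            bᵢⱼ C * fromℕ y ≤ bᵢⱼ C * fromℕ y′ → At C x y → At C x′ y′
  At-mono C _ _ x≤ y≤ p = ≤-trans p (+-mono-≤ x≤ y≤)

  medianPoint : (Fin 3 → Point n) → Point n
  medianPoint s k = proj₁ (median (λ t → s t k))

  medianPoint-isMedian : ∀ s k → IsMedian (medianPoint s k) (λ t → s t k)
  medianPoint-isMedian s k = proj₂ (median (λ t → s t k))

  -- For either sign of a coefficient, the median does at least as well in that term as a majority
  -- of the three points. The majorities of the two terms meet in a point `s t`, and its constraint
  -- carries over. With three variables the majorities could fail to meet.
  median-feas : ∀ s → (∀ t → Feas (s t)) → Feas (medianPoint s)
  median-feas s feas = All.tabulate λ {C} C∈A →
    let (t , x≤ , y≤) = two-meet (two-scale (aᵢⱼ C) (medianPoint-isMedian s (i C)))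
                                 (two-scale (bᵢⱼ C) (medianPoint-isMedian s (j C)))
    in At-mono C (s t (i C)) {medianPoint s (i C)} (s t (j C)) {medianPoint s (j C)} x≤ y≤ (All.lookup (feas t) C∈A)

  FeasBelow : Point n → Set _
  FeasBelow h = ∃ λ s → Feas s × s ≤̇ h

  -- Induction on the number k of leading coordinates in which s is already
  -- below h, keeping one further coordinate l free: the median of the points
  -- for (k, l), (k, k) and {k, l} is the point for (k + 1, l).
  helly : ∀ h → ∃ Feas → (∀ k l → ∃ λ s → Feas s × s k ℕ.≤ h k × s l ℕ.≤ h l) → FeasBelow h
  helly h feasible pairs with Fin.any? {n = n} (λ _ → yes tt)
  ... | no  empty   = proj₁ feasible , proj₂ feasible , λ k → contradiction (k , tt) empty
  ... | yes (l , _) = let (s , feas , s≤h , _) = partial n l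
                      in s , feas , λ k → s≤h k (Fin.toℕ<n k)
    where
    partial : ∀ k l → ∃ λ s → Feas s × (∀ j → toℕ j ℕ.< k → s j ℕ.≤ h j) × s l ℕ.≤ h l
    partial zero l with pairs l l
    ... | s , feas , sl≤hl , _ = s , feas , (λ _ ()) , sl≤hl
    partial (suc k) l with k ℕ.<? n
    ... | no k≮n with partial k l
    ...   | s , feas , s≤h , sl≤hl =
      s , feas , (λ j _ → s≤h j (ℕ.<-≤-trans (Fin.toℕ<n j) (ℕ.≮⇒≥ k≮n))) , sl≤hl
    partial (suc k) l | yes k<n =
      medianPoint s , median-feas s (λ { 0F → feas₀ ; 1F → feas₁ ; 2F → feas₂ }) , below ,
      two-≤⇒median-≤ (medianPoint-isMedian s l) (two₀₂ s₀l≤hl s₂l≤hl)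
      where
      k′ = Fin.fromℕ< k<n
      point₀ = partial k l
      point₁ = partial k k′
      point₂ = pairs k′ l
      s : Fin 3 → Point n
      s 0F = proj₁ point₀
      s 1F = proj₁ point₁
      s 2F = proj₁ point₂
      feas₀  = proj₁ (proj₂ point₀)
      feas₁  = proj₁ (proj₂ point₁)
      feas₂  = proj₁ (proj₂ point₂)
      s₀l≤hl = proj₂ (proj₂ (proj₂ point₀))
      s₂l≤hl = proj₂ (proj₂ (proj₂ point₂))
      below : ∀ j → toℕ j ℕ.< suc k → medianPoint s j ℕ.≤ h j
      below j j<1+k with j Fin.≟ k′
      ... | yes refl = two-≤⇒median-≤ (medianPoint-isMedian s k′)
        (two₁₂ (proj₂ (proj₂ (proj₂ point₁))) (proj₁ (proj₂ (proj₂ point₂))))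
      ... | no  j≢k′ = two-≤⇒median-≤ (medianPoint-isMedian s j)
        (two₀₁ (proj₁ (proj₂ (proj₂ point₀)) j j<k) (proj₁ (proj₂ (proj₂ point₁)) j j<k))
        where
        j<k : toℕ j ℕ.< k
        j<k = ℕ.≤∧≢⇒< (ℕ.s≤s⁻¹ j<1+k)
                (λ j≡k → j≢k′ (Fin.toℕ-injective (trans j≡k (sym (Fin.toℕ-fromℕ< k<n)))))

  -- Bound propagation.

  Corner : Box n → Constraint n → Set ℓ₂
  Corner B C = At C (lo B (i C)) (lo B (j C)) ⊎ At C (lo B (i C)) (hi B (j C)) ⊎
               At C (hi B (i C)) (lo B (j C)) ⊎ At C (hi B (i C)) (hi B (j C))

  corner? : ∀ B C → Dec (Corner B C)
  corner? B C = (_ ≤? _) ⊎-dec (_ ≤? _) ⊎-dec (_ ≤? _) ⊎-dec (_ ≤? _)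

  Consistent : Box n → Set _
  Consistent B = All (Corner B) A

  consistent? : ∀ B → Dec (Consistent B)
  consistent? B = All.all? (corner? B) A

  Corner-cong : ∀ {B B′} → B ≗ B′ → ∀ {C} → Corner B C → Corner B′ C
  Corner-cong {B} {B′} B≗B′ {C} with B (i C) | B′ (i C) | B≗B′ (i C) | B (j C) | B′ (j C) | B≗B′ (j C)
  ... | _ | _ | refl | _ | _ | refl = λ p → p

  endpoint : ∀ a {l v h} → l ℕ.≤ v → v ℕ.≤ h →
             a * fromℕ v ≤ a * fromℕ l ⊎ a * fromℕ v ≤ a * fromℕ h
  endpoint a l≤v v≤h with ≤-total 0# a
  ... | inj₁ 0≤a = inj₂ (*-monoˡ-≤ 0≤a (fromℕ-mono-≤ v≤h))
  ... | inj₂ a≤0 = inj₁ (*-antimonoˡ-≤ a≤0 (fromℕ-mono-≤ l≤v))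

  -- Each term moves to the endpoint that the sign of its coefficient prefers. If `i = j`, the two
  -- terms may prefer different endpoints; the mixed corner is then no point of the box, so `Corner`
  -- is only a necessary condition, until the box is fixed at that coordinate.
  sat⇒corner : ∀ {s B} → s ∈ᵇ B → ∀ {C} → Sat s C → Corner B C
  sat⇒corner {s} {B} (lo≤s , s≤hi) {C} sat
    with endpoint (aᵢⱼ C) (lo≤s (i C)) (s≤hi (i C)) | endpoint (bᵢⱼ C) (lo≤s (j C)) (s≤hi (j C))
  ... | inj₁ x≤ | inj₁ y≤ = inj₁ (At-mono C (s (i C)) {lo B (i C)} (s (j C)) {lo B (j C)} x≤ y≤ sat)
  ... | inj₁ x≤ | inj₂ y≤ = inj₂ (inj₁ (At-mono C (s (i C)) {lo B (i C)} (s (j C)) {hi B (j C)} x≤ y≤ sat))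
  ... | inj₂ x≤ | inj₁ y≤ = inj₂ (inj₂ (inj₁ (At-mono C (s (i C)) {hi B (i C)} (s (j C)) {lo B (j C)} x≤ y≤ sat)))
  ... | inj₂ x≤ | inj₂ y≤ = inj₂ (inj₂ (inj₂ (At-mono C (s (i C)) {hi B (i C)} (s (j C)) {hi B (j C)} x≤ y≤ sat)))

  feas⇒consistent : ∀ {s B} → s ∈ᵇ B → Feas s → Consistent B
  feas⇒consistent s∈B = All.map (sat⇒corner s∈B)

  -- All endpoints are tested against the same old box and move by at most one, so a round is a
  -- single map over the coordinates.
  tighten : Box n → Box n
  tighten B k =
    (if does (consistent? (fix B k (lo B k))) then lo B k else suc (lo B k)) ,
    (if does (consistent? (fix B k (hi B k))) then hi B k else pred (hi B k))

  propagate : ℕ → Box n → Box n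
  propagate zero    B = B
  propagate (suc m) B = tighten (propagate m B)

  Fixed : Box n → Fin n → Set _
  Fixed B k = Consistent (fix B k (lo B k)) × Consistent (fix B k (hi B k))

  fixed? : ∀ B k → Dec (Fixed B k)
  fixed? B k = consistent? (fix B k (lo B k)) ×-dec consistent? (fix B k (hi B k))

  Nonempty : Box n → Set
  Nonempty B = lo B ≤̇ hi B

  tighten-shrinks : ∀ B k → lo B k ℕ.≤ lo (tighten B) k × hi (tighten B) k ℕ.≤ hi B k
  tighten-shrinks B k with consistent? (fix B k (lo B k)) | consistent? (fix B k (hi B k))
  ... | yes _ | yes _ = ℕ.≤-refl , ℕ.≤-refl
  ... | yes _ | no  _ = ℕ.≤-refl , ℕ.pred[n]≤n
  ... | no  _ | yes _ = ℕ.n≤1+n _ , ℕ.≤-refl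
  ... | no  _ | no  _ = ℕ.n≤1+n _ , ℕ.pred[n]≤n

  propagate-hi : ∀ m B → hi (propagate m B) ≤̇ hi B
  propagate-hi zero    B k = ℕ.≤-refl
  propagate-hi (suc m) B k = ℕ.≤-trans (proj₂ (tighten-shrinks (propagate m B) k)) (propagate-hi m B k)

  tighten-nonempty⁻ : ∀ B → Nonempty (tighten B) → Nonempty B
  tighten-nonempty⁻ B ne k =
    ℕ.≤-trans (proj₁ (tighten-shrinks B k)) (ℕ.≤-trans (ne k) (proj₂ (tighten-shrinks B k)))

  tighten-fixed : ∀ B → (∀ k → Fixed B k) → tighten B ≗ B
  tighten-fixed B fixed k
    rewrite dec-true (consistent? (fix B k (lo B k))) (proj₁ (fixed k))
          | dec-true (consistent? (fix B k (hi B k))) (proj₂ (fixed k)) = refl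

  Fixed-cong : ∀ {B B′} → B ≗ B′ → ∀ {k} → Fixed B k → Fixed B′ k
  Fixed-cong {B} {B′} B≗B′ {k} with B k | B′ k | B≗B′ k
  ... | _ | _ | refl = λ (p , q) → All.map (Corner-cong (updateAt-cong k B≗B′)) p ,
                                   All.map (Corner-cong (updateAt-cong k B≗B′)) q

  -- A feasible point passes the test with any coordinate fixed at its own value. A rejected
  -- endpoint therefore differs from that value, and the bound can move by one without losing `s`.
  ∈ᵇ-tighten : ∀ {s B} → Feas s → s ∈ᵇ B → s ∈ᵇ tighten B
  ∈ᵇ-tighten {s} {B} feas s∈B@(lo≤s , s≤hi) = below , above
    where
    consistent : ∀ {v} k → v ≡ s k → Consistent (fix B k v)
    consistent k refl = feas⇒consistent (∈ᵇ-fix s∈B) feas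
    below : lo (tighten B) ≤̇ s
    below k with consistent? (fix B k (lo B k))
    ... | yes _ = lo≤s k
    ... | no ¬c = ℕ.≤∧≢⇒< (lo≤s k) (¬c ∘ consistent k)
    above : s ≤̇ hi (tighten B)
    above k with consistent? (fix B k (hi B k))
    ... | yes _ = s≤hi k
    ... | no ¬c = ℕ.<⇒≤pred (ℕ.≤∧≢⇒< (s≤hi k) (¬c ∘ consistent k ∘ sym))

  ∈ᵇ-propagate : ∀ {s B} m → Feas s → s ∈ᵇ B → s ∈ᵇ propagate m B
  ∈ᵇ-propagate zero    feas s∈B = s∈B
  ∈ᵇ-propagate (suc m) feas s∈B = ∈ᵇ-tighten feas (∈ᵇ-propagate m feas s∈B)

  -- The measure that limits the rounds. Owing to `suc`, the step from a one-point interval to an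
  -- empty one still counts as a decrease.
  width : Box n → ℕ
  width B = sum (map (λ k → suc (hi B k) ∸ lo B k) (allFin n))

  tighten-width : ∀ B → Nonempty B → ∀ k → ¬ Fixed B k → width (tighten B) ℕ.< width B
  tighten-width B ne k ¬fixed = sum-mono-< weak (∈-allFin k) strict
    where
    weak : ∀ k → suc (hi (tighten B) k) ∸ lo (tighten B) k ℕ.≤ suc (hi B k) ∸ lo B k
    weak k = ℕ.∸-mono (s≤s (proj₂ (tighten-shrinks B k))) (proj₁ (tighten-shrinks B k))
    shrink : ∀ {h h′ l} → l ℕ.≤ h → h′ ℕ.≤ h → suc h′ ∸ suc l ℕ.< suc h ∸ l
    shrink {h} {h′} {l} l≤h h′≤h = ℕ.≤-<-trans (ℕ.∸-monoˡ-≤ l h′≤h)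
      (ℕ.∸-monoˡ-< (ℕ.n<1+n h) l≤h)
    strict : suc (hi (tighten B) k) ∸ lo (tighten B) k ℕ.< suc (hi B k) ∸ lo B k
    strict with consistent? (fix B k (lo B k)) | consistent? (fix B k (hi B k))
    ... | yes p | yes q = contradiction (p , q) ¬fixed
    ... | no  _ | yes _ = shrink (ne k) ℕ.≤-refl
    ... | no  _ | no  _ = shrink (ne k) ℕ.pred[n]≤n
    ... | yes p | no ¬q with hi B k | ne k
    -- Here `pred` cannot lower the upper bound. But then both endpoints are 0, and a single test
    -- cannot both succeed and fail.
    ...   | zero  | lo≤0 = contradiction (subst (Consistent ∘ fix B k) (ℕ.n≤0⇒n≡0 lo≤0) p) ¬q
    ...   | suc h | lo≤1+h = ℕ.∸-monoˡ-< (ℕ.n<1+n (suc h)) lo≤1+h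

  tighten-progress : ∀ B m {b} → Nonempty B → (∀ k → Fixed B k) ⊎ width B ℕ.+ m ℕ.≤ b →
    (∀ k → Fixed (tighten B) k) ⊎ width (tighten B) ℕ.+ suc m ℕ.≤ b
  tighten-progress B m ne (inj₁ fixed) =
    inj₁ (λ k → Fixed-cong (λ l → sym (tighten-fixed B fixed l)) (fixed k))
  tighten-progress B m ne (inj₂ w≤) = case Fin.all? (fixed? B) of λ where
    (yes fixed) → tighten-progress B m ne (inj₁ fixed)
    (no ¬fixed) → let (k , ¬fixedₖ) = Fin.¬∀⟶∃¬ n _ (fixed? B) ¬fixed in
      inj₂ (ℕ.≤-trans (ℕ.≤-reflexive (ℕ.+-suc _ m))
           (ℕ.≤-trans (ℕ.+-monoˡ-≤ m (tighten-width B ne k ¬fixedₖ)) w≤))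

  propagate-progress : ∀ B m → Nonempty (propagate m B) →
    (∀ k → Fixed (propagate m B) k) ⊎ width (propagate m B) ℕ.+ m ℕ.≤ width B
  propagate-progress B zero    ne = inj₂ (ℕ.≤-reflexive (ℕ.+-identityʳ (width B)))
  propagate-progress B (suc m) ne = tighten-progress (propagate m B) m ne′ (propagate-progress B m ne′)
    where ne′ = tighten-nonempty⁻ (propagate m B) ne

  -- Stability persists, and every round on an unstable nonempty box uses up a unit of `width`.
  -- After `m` rounds nothing is left to pay for another one.
  propagate-fixed : ∀ B m → width B ℕ.≤ m → Nonempty (propagate m B) → ∀ k → Fixed (propagate m B) k
  propagate-fixed B m wB≤m ne with Fin.all? (fixed? (propagate m B)) | propagate-progress B m ne
  ... | yes fixed | _          = fixed
  ... | no ¬fixed | inj₁ fixed = fixed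
  ... | no ¬fixed | inj₂ w≤    with Fin.¬∀⟶∃¬ n _ (fixed? (propagate m B)) ¬fixed
  ...   | k , ¬fixedₖ = contradiction
    (ℕ.≤-trans (ℕ.+-monoˡ-≤ m (tighten-width (propagate m B) ne k ¬fixedₖ)) (ℕ.≤-trans w≤ wB≤m))
    (ℕ.m+n≮n _ m)

  fix-supportsʲ : ∀ B C {v} → v ≡ lo B (j C) ⊎ v ≡ hi B (j C) → Corner (fix B (j C) v) C →
                  ∃ λ x → (x ≡ lo B (i C) ⊎ x ≡ hi B (i C)) × At C x v
  fix-supportsʲ B C {v} v∈ corner with fix-other B (j C) (i C) v∈ | updateAt-updates (j C) {const (v , v)} B | corner
  ... | p , q | fixed | inj₁ at               = _ , p , subst (At C (lo (fix B (j C) v) (i C))) (cong proj₁ fixed) at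
  ... | p , q | fixed | inj₂ (inj₁ at)        = _ , p , subst (At C (lo (fix B (j C) v) (i C))) (cong proj₂ fixed) at
  ... | p , q | fixed | inj₂ (inj₂ (inj₁ at)) = _ , q , subst (At C (hi (fix B (j C) v) (i C))) (cong proj₁ fixed) at
  ... | p , q | fixed | inj₂ (inj₂ (inj₂ at)) = _ , q , subst (At C (hi (fix B (j C) v) (i C))) (cong proj₂ fixed) at

  fix-supportsⁱ : ∀ B C {v} → v ≡ lo B (i C) ⊎ v ≡ hi B (i C) → Corner (fix B (i C) v) C →
                  ∃ λ y → (y ≡ lo B (j C) ⊎ y ≡ hi B (j C)) × At C v y
  fix-supportsⁱ B C {v} v∈ corner with fix-other B (i C) (j C) v∈ | updateAt-updates (i C) {const (v , v)} B | corner
  ... | p , q | fixed | inj₁ at               = _ , p , subst (λ x → At C x (lo (fix B (i C) v) (j C))) (cong proj₁ fixed) at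
  ... | p , q | fixed | inj₂ (inj₁ at)        = _ , q , subst (λ x → At C x (hi (fix B (i C) v) (j C))) (cong proj₁ fixed) at
  ... | p , q | fixed | inj₂ (inj₂ (inj₁ at)) = _ , p , subst (λ x → At C x (lo (fix B (i C) v) (j C))) (cong proj₂ fixed) at
  ... | p , q | fixed | inj₂ (inj₂ (inj₂ at)) = _ , q , subst (λ x → At C x (hi (fix B (i C) v) (j C))) (cong proj₂ fixed) at

  clampPoints : Box n → Point n → Fin 3 → Point n
  clampPoints B s 0F = lo B
  clampPoints B s 1F = s
  clampPoints B s 2F = hi B

  -- Clamping written as the median of `lo`, `s` and `hi`: for either sign of a coefficient
  -- `two-scale` then names two of the three that the result dominates.
  clamp : Box n → Point n → Point n
  clamp B s = medianPoint (clampPoints B s)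

  clamp-≤-hi : ∀ {B} s → Nonempty B → clamp B s ≤̇ hi B
  clamp-≤-hi {B} s ne k =
    two-≤⇒median-≤ (medianPoint-isMedian (clampPoints B s) k) (two₀₂ (ne k) ℕ.≤-refl)

  -- If the clamped coordinate i is worse for the constraint than that of s, it
  -- is the best one of the box, and then an endpoint at j is enough.
  clamp-feas : ∀ {B s} → (∀ k → Fixed B k) → Feas s → Feas (clamp B s)
  clamp-feas {B} {s} fixed feas = All.tabulate λ {C} C∈A →
    sat C (All.lookup feas C∈A)
      (λ k → All.lookup (proj₁ (fixed k)) C∈A) (λ k → All.lookup (proj₂ (fixed k)) C∈A)
      (two-scale (aᵢⱼ C) (medianPoint-isMedian (clampPoints B s) (i C)))
      (two-scale (bᵢⱼ C) (medianPoint-isMedian (clampPoints B s) (j C)))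
    where
    y = clamp B s
    _≼⟨_⟩_ : ℕ → Carrier → ℕ → Set _
    x ≼⟨ a ⟩ z = a * fromℕ x ≤ a * fromℕ z
    sat : ∀ C → Sat s C → (∀ k → Corner (fix B k (lo B k)) C) → (∀ k → Corner (fix B k (hi B k)) C) →
          Two (λ t → clampPoints B s t (i C) ≼⟨ aᵢⱼ C ⟩ y (i C)) →
          Two (λ t → clampPoints B s t (j C) ≼⟨ bᵢⱼ C ⟩ y (j C)) → Sat y C
    sat C sat-s clo chi = go
      where
      fromᵢ : lo B (i C) ≼⟨ aᵢⱼ C ⟩ y (i C) → hi B (i C) ≼⟨ aᵢⱼ C ⟩ y (i C) →
              ∀ v → v ≼⟨ bᵢⱼ C ⟩ y (j C) →
              (∃ λ x → (x ≡ lo B (i C) ⊎ x ≡ hi B (i C)) × At C x v) → Sat y C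
      fromᵢ p q v r (_ , inj₁ refl , at) = At-mono C (lo B (i C)) {y (i C)} v {y (j C)} p r at
      fromᵢ p q v r (_ , inj₂ refl , at) = At-mono C (hi B (i C)) {y (i C)} v {y (j C)} q r at
      fromⱼ : lo B (j C) ≼⟨ bᵢⱼ C ⟩ y (j C) → hi B (j C) ≼⟨ bᵢⱼ C ⟩ y (j C) →
              ∀ v → v ≼⟨ aᵢⱼ C ⟩ y (i C) →
              (∃ λ x → (x ≡ lo B (j C) ⊎ x ≡ hi B (j C)) × At C v x) → Sat y C
      fromⱼ p q v r (_ , inj₁ refl , at) = At-mono C v {y (i C)} (lo B (j C)) {y (j C)} r p at
      fromⱼ p q v r (_ , inj₂ refl , at) = At-mono C v {y (i C)} (hi B (j C)) {y (j C)} r q at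
      lowⱼ  = fix-supportsʲ B C (inj₁ refl) (clo (j C))
      highⱼ = fix-supportsʲ B C (inj₂ refl) (chi (j C))
      lowᵢ  = fix-supportsⁱ B C (inj₁ refl) (clo (i C))
      highᵢ = fix-supportsⁱ B C (inj₂ refl) (chi (i C))
      both : s (i C) ≼⟨ aᵢⱼ C ⟩ y (i C) → s (j C) ≼⟨ bᵢⱼ C ⟩ y (j C) → Sat y C
      both p q = At-mono C (s (i C)) {y (i C)} (s (j C)) {y (j C)} p q sat-s
      go : Two (λ t → clampPoints B s t (i C) ≼⟨ aᵢⱼ C ⟩ y (i C)) →
           Two (λ t → clampPoints B s t (j C) ≼⟨ bᵢⱼ C ⟩ y (j C)) → Sat y C
      go (two₀₁ _ p) (two₀₁ _ q) = both p q
      go (two₀₁ _ p) (two₁₂ q _) = both p q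
      go (two₁₂ p _) (two₀₁ _ q) = both p q
      go (two₁₂ p _) (two₁₂ q _) = both p q
      go (two₀₂ p q) (two₀₁ r _) = fromᵢ p q (lo B (j C)) r lowⱼ
      go (two₀₂ p q) (two₀₂ r _) = fromᵢ p q (lo B (j C)) r lowⱼ
      go (two₀₂ p q) (two₁₂ _ r) = fromᵢ p q (hi B (j C)) r highⱼ
      go (two₀₁ r _) (two₀₂ p q) = fromⱼ p q (lo B (i C)) r lowᵢ
      go (two₁₂ _ r) (two₀₂ p q) = fromⱼ p q (hi B (i C)) r highᵢ

  below : Point n → Box n
  below h k = 0 , h k

  propagation-sound : ∀ {h} m → FeasBelow h → Nonempty (propagate m (below h))
  propagation-sound m (s , feas , s≤h) =
    let (lo≤s , s≤hi) = ∈ᵇ-propagate m feas ((λ _ → z≤n) , s≤h)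
    in λ k → ℕ.≤-trans (lo≤s k) (s≤hi k)

  -- A stable nonempty box may well contain no feasible point when the constraints are
  -- contradictory. A feasible point known elsewhere is clamped into it. The bound on `m` is the
  -- width of `below h`.
  propagation-complete : ∀ {h} m → ∃ Feas → sum (map (suc ∘ h) (allFin n)) ℕ.≤ m →
                         Nonempty (propagate m (below h)) → FeasBelow h
  propagation-complete {h} m (s , feas) ∑≤m ne =
    clamp B s , clamp-feas (propagate-fixed (below h) m ∑≤m ne) feas ,
    λ k → ℕ.≤-trans (clamp-≤-hi s ne k) (propagate-hi m (below h) k)
    where B = propagate m (below h)

  feasBelow? : ∃ Feas → ∀ h → Dec (FeasBelow h)
  feasBelow? feasible h =
    map′ (propagation-complete m feasible ℕ.≤-refl) (propagation-sound m) (Fin.all? (λ k → _ ℕ.≤? _))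
    where m = sum (map (suc ∘ h) (allFin n))

-- Multi-sets and literals

pointwise : ∀ {x y : Vec ℕ n} → (∀ k → lookup x k ℕ.≤ lookup y k) → Pointwise ℕ._≤_ x y
pointwise {x = []}    {[]}    _   = []
pointwise {x = _ ∷ _} {_ ∷ _} x≤y = x≤y Fin.zero ∷ pointwise (λ k → x≤y (Fin.suc k))

module _ {u : Vec ℕ n} where

  toPoint : MultiSet u → Point n
  toPoint X = lookup (mult X)

  toPoint-≤ : (X : MultiSet u) → toPoint X ≤̇ lookup u
  toPoint-≤ (mkMultiSet x x≤u) k =
    recompute (lookup x k ℕ.≤? lookup u k) (Pointwise.lookup x≤u k)

  fromPoint : (s : Point n) → .(s ≤̇ lookup u) → MultiSet u
  fromPoint s s≤u = mkMultiSet (Vec.tabulate s)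
    (pointwise (λ k → subst (ℕ._≤ lookup u k) (sym (Vec.lookup∘tabulate s k)) (s≤u k)))

  toPoint∘fromPoint : ∀ s .(s≤u : s ≤̇ lookup u) → toPoint (fromPoint s s≤u) ≗ s
  toPoint∘fromPoint s _ = Vec.lookup∘tabulate s

  ⊆-fromPoints : {X Y : MultiSet u} → toPoint X ≤̇ toPoint Y → X ⊆ Y
  ⊆-fromPoints = pointwise

  ⊆-toPoints : {X Y : MultiSet u} → X ⊆ Y → toPoint X ≤̇ toPoint Y
  ⊆-toPoints = Pointwise.lookup

  mult-injective : {X Y : MultiSet u} → mult X ≡ mult Y → X ≡ Y
  mult-injective {mkMultiSet x _} {mkMultiSet .x _} refl = refl

  toPoint-∪ : ∀ (X Y : MultiSet u) k → toPoint (X ∪ Y) k ≡ toPoint X k ℕ.⊔ toPoint Y k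
  toPoint-∪ X Y k = Vec.lookup-zipWith ℕ._⊔_ k (mult X) (mult Y)

  toPoint-∩ : ∀ (X Y : MultiSet u) k → toPoint (X ∩ Y) k ≡ toPoint X k ℕ.⊓ toPoint Y k
  toPoint-∩ X Y k = Vec.lookup-zipWith ℕ._⊓_ k (mult X) (mult Y)

  x⊆x∪y : (X Y : MultiSet u) → X ⊆ X ∪ Y
  x⊆x∪y X Y = ⊆-fromPoints {X} {X ∪ Y} λ k →
    ℕ.≤-trans (ℕ.m≤m⊔n _ (toPoint Y k)) (ℕ.≤-reflexive (sym (toPoint-∪ X Y k)))

  y⊆x∪y : (X Y : MultiSet u) → Y ⊆ X ∪ Y
  y⊆x∪y X Y = ⊆-fromPoints {Y} {X ∪ Y} λ k →
    ℕ.≤-trans (ℕ.m≤n⊔m (toPoint X k) _) (ℕ.≤-reflexive (sym (toPoint-∪ X Y k)))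

  ∪-lub : {X Y Z : MultiSet u} → X ⊆ Z → Y ⊆ Z → X ∪ Y ⊆ Z
  ∪-lub {X} {Y} {Z} X⊆Z Y⊆Z = ⊆-fromPoints {X ∪ Y} {Z} λ k →
    ℕ.≤-trans (ℕ.≤-reflexive (toPoint-∪ X Y k))
              (ℕ.⊔-lub (⊆-toPoints {X} {Z} X⊆Z k) (⊆-toPoints {Y} {Z} Y⊆Z k))

  ∩-glb : {X Y Z : MultiSet u} → Z ⊆ X → Z ⊆ Y → Z ⊆ X ∩ Y
  ∩-glb {X} {Y} {Z} Z⊆X Z⊆Y = ⊆-fromPoints {Z} {X ∩ Y} λ k →
    ℕ.≤-trans (ℕ.⊓-glb (⊆-toPoints {Z} {X} Z⊆X k) (⊆-toPoints {Z} {Y} Z⊆Y k))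
              (ℕ.≤-reflexive (sym (toPoint-∩ X Y k)))

  ⊆-trans : {X Y Z : MultiSet u} → X ⊆ Y → Y ⊆ Z → X ⊆ Z
  ⊆-trans = Pointwise.trans ℕ.≤-trans

  ∅ full : MultiSet u
  ∅    = fromPoint (λ _ → 0) (λ _ → z≤n)
  full = fromPoint (lookup u) (λ _ → ℕ.≤-refl)

-- The literal x_coord > level.
record Literal (u : Vec ℕ n) : Set where
  constructor literal
  field
    coord    : Fin n
    level    : ℕ
    .level<u : level ℕ.< lookup u coord

open Literal public

module _ {u : Vec ℕ n} where

  _⊨_ : Point n → Literal u → Set
  s ⊨ e = level e ℕ.< s (coord e)

  raisePoint : Literal u → Point n → Point n
  raisePoint e s = updateAt s (coord e) (suc (level e) ℕ.⊔_)

  raisePoint-inflationary : ∀ e s → s ≤̇ raisePoint e s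
  raisePoint-inflationary e s k with k Fin.≟ coord e
  ... | yes refl = ℕ.≤-trans (ℕ.m≤n⊔m (suc (level e)) (s k)) (ℕ.≤-reflexive (sym (updateAt-updates k s)))
  ... | no  k≢i  = ℕ.≤-reflexive (sym (updateAt-minimal k (coord e) s k≢i))

  raisePoint-lub : ∀ e {s t} → s ≤̇ t → t ⊨ e → raisePoint e s ≤̇ t
  raisePoint-lub e {s} {t} s≤t t⊨e k with k Fin.≟ coord e
  ... | yes refl = ℕ.≤-trans (ℕ.≤-reflexive (updateAt-updates k s)) (ℕ.⊔-lub t⊨e (s≤t k))
  ... | no  k≢i  = ℕ.≤-trans (ℕ.≤-reflexive (updateAt-minimal k (coord e) s k≢i)) (s≤t k)

  raisePoint-⊨ : ∀ e s → raisePoint e s ⊨ e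
  raisePoint-⊨ e s = ℕ.≤-trans (ℕ.m≤m⊔n (suc (level e)) (s (coord e)))
                               (ℕ.≤-reflexive (sym (updateAt-updates (coord e) s)))

  raise : Literal u → MultiSet u → MultiSet u
  raise e@(literal _ _ p<u) X = fromPoint (raisePoint e (toPoint X))
                                          (raisePoint-lub e (toPoint-≤ X) p<u)

  raise-inflationary : ∀ e X → X ⊆ raise e X
  raise-inflationary e X = ⊆-fromPoints {X = X} {raise e X} λ k →
    subst (toPoint X k ℕ.≤_) (sym (Vec.lookup∘tabulate _ k)) (raisePoint-inflationary e (toPoint X) k)

  raise-lub : ∀ e {X Y} → X ⊆ Y → toPoint Y ⊨ e → raise e X ⊆ Y
  raise-lub e {X} {Y} X⊆Y Y⊨e = ⊆-fromPoints {X = raise e X} {Y} λ k →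
    subst (ℕ._≤ toPoint Y k) (sym (Vec.lookup∘tabulate _ k))
          (raisePoint-lub e (⊆-toPoints {X = X} {Y} X⊆Y) Y⊨e k)

  raise-⊨ : ∀ e X → toPoint (raise e X) ⊨ e
  raise-⊨ e X = subst (level e ℕ.<_) (sym (Vec.lookup∘tabulate _ (coord e))) (raisePoint-⊨ e (toPoint X))

module _ {u : Vec ℕ n} where

  capPoint : Literal u → Point n → Point n
  capPoint e s = updateAt s (coord e) (level e ℕ.⊓_)

  capPoint-≤ : ∀ e s → capPoint e s ≤̇ s
  capPoint-≤ e s k with k Fin.≟ coord e
  ... | yes refl = ℕ.≤-trans (ℕ.≤-reflexive (updateAt-updates k s)) (ℕ.m⊓n≤n (level e) (s k))
  ... | no  k≢i  = ℕ.≤-reflexive (updateAt-minimal k (coord e) s k≢i)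

  capPoint-⊭ : ∀ e s → capPoint e s (coord e) ℕ.≤ level e
  capPoint-⊭ e s = ℕ.≤-trans (ℕ.≤-reflexive (updateAt-updates (coord e) s)) (ℕ.m⊓n≤m (level e) _)

  capPoint-glb : ∀ e {s t} → t ≤̇ s → t (coord e) ℕ.≤ level e → t ≤̇ capPoint e s
  capPoint-glb e {s} {t} t≤s t≤p k with k Fin.≟ coord e
  ... | yes refl = ℕ.≤-trans (ℕ.⊓-glb t≤p (t≤s k)) (ℕ.≤-reflexive (sym (updateAt-updates k s)))
  ... | no  k≢i  = ℕ.≤-trans (t≤s k) (ℕ.≤-reflexive (sym (updateAt-minimal k (coord e) s k≢i)))

  -- The accumulator mirrors the inner loop of `literalsT`, which conses onto the result of the
  -- outer loop.
  levels : ∀ i m → .(m ℕ.≤ lookup u i) → List (Literal u) → List (Literal u)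
  levels i zero    _   es = es
  levels i (suc m) m<u es = literal i m m<u ∷ levels i m (ℕ.<⇒≤ m<u) es

  literalsAt : List (Fin n) → List (Literal u)
  literalsAt []       = []
  literalsAt (i ∷ is) = levels i (lookup u i) ℕ.≤-refl (literalsAt is)

  literals : List (Literal u)
  literals = literalsAt (allFin n)

  length-levels : ∀ i m .m≤u es → length (levels i m m≤u es) ≡ m ℕ.+ length es
  length-levels i zero    _ es = refl
  length-levels i (suc m) _ es = cong suc (length-levels i m _ es)

  length-literalsAt : ∀ is → length (literalsAt is) ≡ sum (map (lookup u) is)
  length-literalsAt []       = refl
  length-literalsAt (i ∷ is) =
    trans (length-levels i (lookup u i) _ _) (cong (lookup u i ℕ.+_) (length-literalsAt is))

  ∈-levels⁺ : ∀ {e es} i m .m≤u → e ∈ es → e ∈ levels i m m≤u es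
  ∈-levels⁺ i zero    _ e∈es = e∈es
  ∈-levels⁺ i (suc m) _ e∈es = there (∈-levels⁺ i m _ e∈es)

  ∈-levels : ∀ {i p es} m .m≤u (p<m : p ℕ.< m) .(p<u : p ℕ.< lookup u i) → literal i p p<u ∈ levels i m m≤u es
  ∈-levels {p = p} (suc m) _ p<1+m p<u with p ℕ.≟ m
  ... | yes refl = here refl
  ... | no  p≢m  = there (∈-levels m _ (ℕ.≤∧≢⇒< (ℕ.s≤s⁻¹ p<1+m) p≢m) p<u)

  ∈-literalsAt : ∀ {i p is} → i ∈ is → (p<u : p ℕ.< lookup u i) → literal i p p<u ∈ literalsAt is
  ∈-literalsAt {i} (here refl)         p<u = ∈-levels (lookup u i) _ p<u p<u
  ∈-literalsAt     (there {x = j} i∈is) p<u = ∈-levels⁺ j (lookup u j) _ (∈-literalsAt i∈is p<u)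

  ∈-literals : ∀ {i p} (p<u : p ℕ.< lookup u i) → literal i p p<u ∈ literals
  ∈-literals {i} p<u = ∈-literalsAt (∈-allFin i) p<u

-- Weighted families of multi-sets

module WeightedSplitting {c ℓ₁ ℓ₂} (ℝ : RealField c ℓ₁ ℓ₂)
                         {a} {X : Set a} (f : X → RealField.Carrier ℝ) where
  open RealField ℝ
  open OrderedField ℝ
  open Solver
  open SetoidReasoning setoid

  Weighted : Set _
  Weighted = List (Carrier × X)

  total : (X → Carrier) → Weighted → Carrier
  total φ []             = 0#
  total φ ((w , x) ∷ xs) = total φ xs + w * φ x

  Nonneg : Weighted → Set _
  Nonneg = All (λ (w , _) → 0# ≤ w)

  total-mono-≤ : ∀ {φ ψ xs} → Nonneg xs → All (λ (_ , x) → φ x ≤ ψ x) xs → total φ xs ≤ total ψ xs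
  total-mono-≤ []       []       = ≤-refl
  total-mono-≤ (p ∷ ps) (q ∷ qs) = +-mono-≤ (total-mono-≤ ps qs) (*-monoˡ-≤ p q)

  total-const : ∀ b xs → total (λ _ → b) xs ≈ total (λ _ → 1#) xs * b
  total-const b []             = ≈-sym (zeroˡ b)
  total-const b ((w , _) ∷ xs) = begin
    total (λ _ → b) xs + w * b             ≈⟨ +-cong (total-const b xs) (*-congʳ (≈-sym (*-identityʳ w))) ⟩
    total (λ _ → 1#) xs * b + w * 1# * b   ≈⟨ solve 3 (λ t v b → t :* b :+ v :* b := (t :+ v) :* b) ≈-refl _ (w * 1#) b ⟩
    (total (λ _ → 1#) xs + w * 1#) * b     ∎

  gain : (X → X) → X → Carrier
  gain W x = f (W x) - f x

  module _ (U V : X → X) where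

    -- Giving a set to `U` instead of `V` changes the balance by both gains: one is spent, and the
    -- other no longer has to be.
    increment : Carrier → X → Carrier
    increment w x = w * (gain U x + gain V x)

    -- The fraction `- r / increment w x` of the weight, which brings a negative balance `r` to
    -- exactly zero.
    firstShare : Carrier → Carrier → X → Carrier
    firstShare w r x = w * ((- r) * increment w x ⁻¹)

    -- The number r is what has been spent on U minus what is still to be
    -- spent on V if all the remaining sets are given to V.
    data Split (r₀ : Carrier) : Weighted → Carrier → Weighted → Set (c ⊔ a ⊔ ℓ₂) where
      done : Split r₀ [] r₀ []
      toU  : ∀ {w x xs r ys} → Split r₀ xs r ys → r + increment w x ≤ 0# →
             Split r₀ ((w , x) ∷ xs) (r + increment w x) ((w , U x) ∷ ys)
      toV  : ∀ {w x xs r ys} → Split r₀ xs r ys → 0# ≤ r →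
             Split r₀ ((w , x) ∷ xs) r ((w , V x) ∷ ys)
      cut  : ∀ {w x xs r ys} → Split r₀ xs r ys → ¬ r + increment w x ≤ 0# → ¬ 0# ≤ r →
             Split r₀ ((w , x) ∷ xs) 0#
                   ((firstShare w r x , U x) ∷ (w - firstShare w r x , V x) ∷ ys)

    module _ (gainU≥0 : ∀ x → 0# ≤ gain U x) (gainV≥0 : ∀ x → 0# ≤ gain V x) where

      increment-nonneg : ∀ {w} x → 0# ≤ w → 0# ≤ increment w x
      increment-nonneg x 0≤w = *-nonneg 0≤w (+-nonneg (gainU≥0 x) (gainV≥0 x))

      module Cut {w x r} (0≤w : 0# ≤ w) (r+d≰0 : ¬ r + increment w x ≤ 0#) (0≰r : ¬ 0# ≤ r) where
        d μ : Carrier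
        d = increment w x
        μ = firstShare w r x

        r≤0 : r ≤ 0#
        r≤0 = ≰⇒≥ 0≰r

        d≉0 : ¬ d ≈ 0#
        d≉0 d≈0 = r+d≰0 (≤-respˡ-≈ (≈-sym (≈-trans (+-congˡ d≈0) (+-identityʳ r))) r≤0)

        d⁻¹-nonneg : 0# ≤ d ⁻¹
        d⁻¹-nonneg = ⁻¹-nonneg (increment-nonneg x 0≤w) d≉0

        μ-nonneg : 0# ≤ μ
        μ-nonneg = *-nonneg 0≤w (*-nonneg (-‿nonneg r≤0) d⁻¹-nonneg)

        w-μ-nonneg : 0# ≤ w - μ
        w-μ-nonneg = ≤-respʳ-≈ (begin
          w * ((r + d) * d ⁻¹)
            ≈⟨ solve 4 (λ w r d i → w :* ((r :+ d) :* i) := w :* (d :* i) :- w :* ((:- r) :* i)) ≈-refl w r d (d ⁻¹) ⟩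
          w * (d * d ⁻¹) - μ  ≈⟨ +-congʳ (*-congˡ (*-inverseʳ d d≉0)) ⟩
          w * 1# - μ          ≈⟨ +-congʳ (*-identityʳ w) ⟩
          w - μ               ∎)
          (*-nonneg 0≤w (*-nonneg (≰⇒≥ r+d≰0) d⁻¹-nonneg))

        μ-gains : μ * (gain U x + gain V x) ≈ - r
        μ-gains = begin
          w * ((- r) * d ⁻¹) * (gain U x + gain V x)
            ≈⟨ solve 4 (λ w r g i → w :* ((:- r) :* i) :* g := (:- r) :* ((w :* g) :* i)) ≈-refl
                 w r (gain U x + gain V x) (d ⁻¹) ⟩
          (- r) * (d * d ⁻¹)  ≈⟨ *-congˡ (*-inverseʳ d d≉0) ⟩
          (- r) * 1#          ≈⟨ *-identityʳ (- r) ⟩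
          - r                 ∎

      split-nonneg : ∀ {r₀ xs r ys} → Split r₀ xs r ys → Nonneg xs → Nonneg ys
      split-nonneg done            []          = []
      split-nonneg (toU s _)       (p ∷ ps) = p ∷ split-nonneg s ps
      split-nonneg (toV s _)       (p ∷ ps) = p ∷ split-nonneg s ps
      split-nonneg (cut s r+d≰0 0≰r) (p ∷ ps) =
        Cut.μ-nonneg p r+d≰0 0≰r ∷ Cut.w-μ-nonneg p r+d≰0 0≰r ∷ split-nonneg s ps

      split-≤0 : ∀ {r₀ xs r ys} → r₀ ≤ 0# → Split r₀ xs r ys → r ≤ 0#
      split-≤0 r₀≤0 done        = r₀≤0
      split-≤0 r₀≤0 (toU _ r≤0) = r≤0
      split-≤0 r₀≤0 (toV s _)   = split-≤0 r₀≤0 s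
      split-≤0 r₀≤0 (cut _ _ _) = ≤-refl

      -- As long as everything goes to `U`, the balance collects all the gains of `V` and more. The
      -- first `toV` or `cut` certifies a nonnegative balance, and no later step lowers it.
      split-≥ : ∀ {r₀ xs r ys} → Nonneg xs → Split r₀ xs r ys →
                0# ≤ r ⊎ r₀ + total (gain V) xs ≤ r
      split-≥ [] done = inj₂ (≤-reflexive (+-identityʳ _))
      split-≥ {r₀} (p ∷ ps) (toU {w} {x} {xs} {r} s _) with split-≥ ps s
      ... | inj₁ 0≤r = inj₁ (+-nonneg 0≤r (increment-nonneg x p))
      ... | inj₂ ≤r  = inj₂ (≈+nonneg⇒≤ (+-nonneg (x≤y⇒0≤y-x ≤r) (*-nonneg p (gainU≥0 x)))
        (solve 6 (λ r r₀ w gU gV t →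
           r :+ w :* (gU :+ gV) := r₀ :+ (t :+ w :* gV) :+ ((r :- (r₀ :+ t)) :+ w :* gU)) ≈-refl
           r r₀ w (gain U x) (gain V x) (total (gain V) xs)))
      split-≥ _ (toV _ 0≤r) = inj₁ 0≤r
      split-≥ _ (cut _ _ _) = inj₁ ≤-refl

      -- At most one set is cut: `cut` needs a negative balance and leaves zero, and the balance
      -- never decreases. The second component strengthens the induction: a negative balance shows
      -- that no cut has happened yet.
      split-length : ∀ {r₀ xs r ys} → Nonneg xs → Split r₀ xs r ys →
                     length ys ℕ.≤ suc (length xs) × (¬ 0# ≤ r → length ys ℕ.≤ length xs)
      split-length [] done = z≤n , λ _ → z≤n
      split-length (p ∷ ps) (toU {x = x} s _) =
        let (long , short) = split-length ps s
        in s≤s long , λ 0≰r+d → s≤s (short (λ 0≤r → 0≰r+d (+-nonneg 0≤r (increment-nonneg x p))))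
      split-length (p ∷ ps) (toV s 0≤r) =
        s≤s (proj₁ (split-length ps s)) , λ 0≰r → contradiction 0≤r 0≰r
      split-length (p ∷ ps) (cut s _ 0≰r) =
        s≤s (s≤s (proj₂ (split-length ps s) 0≰r)) , λ 0≰0 → contradiction ≤-refl 0≰0

      -- The multiplier ε is 1 if the sets given to U decrease φ, and -1 if
      -- those given to V do.
      split-total : ∀ ε φ → (∀ x → φ (U x) + ε * gain U x ≤ φ x) → (∀ x → φ (V x) ≤ φ x + ε * gain V x) →
                    ∀ {r₀ xs r ys} → Nonneg xs → Split r₀ xs r ys →
                    total φ ys + ε * (r - r₀ - total (gain V) xs) ≤ total φ xs
      split-total ε φ φU φV {r₀} [] done = ≤-reflexive
        (solve 2 (λ ε r → con (+ 0) :+ ε :* (r :- r :- con (+ 0)) := con (+ 0)) ≈-refl ε r₀)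
      split-total ε φ φU φV {r₀} (p ∷ ps) (toU {w} {x} {xs} {r} {ys} s _) = ≈+nonneg⇒≤
        (+-nonneg (x≤y⇒0≤y-x (split-total ε φ φU φV ps s)) (*-nonneg p (x≤y⇒0≤y-x (φU x))))
        (solve 11 (λ ε r r₀ w gU gV t T T′ φx φUx →
           T :+ w :* φx :=
           T′ :+ w :* φUx :+ ε :* (r :+ w :* (gU :+ gV) :- r₀ :- (t :+ w :* gV)) :+
           (T :- (T′ :+ ε :* (r :- r₀ :- t)) :+ w :* (φx :- (φUx :+ ε :* gU)))) ≈-refl
           ε r r₀ w (gain U x) (gain V x) (total (gain V) xs) (total φ xs) (total φ ys) (φ x) (φ (U x)))
      split-total ε φ φU φV {r₀} (p ∷ ps) (toV {w} {x} {xs} {r} {ys} s _) = ≈+nonneg⇒≤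
        (+-nonneg (x≤y⇒0≤y-x (split-total ε φ φU φV ps s)) (*-nonneg p (x≤y⇒0≤y-x (φV x))))
        (solve 10 (λ ε r r₀ w gV t T T′ φx φVx →
           T :+ w :* φx :=
           T′ :+ w :* φVx :+ ε :* (r :- r₀ :- (t :+ w :* gV)) :+
           (T :- (T′ :+ ε :* (r :- r₀ :- t)) :+ w :* (φx :+ ε :* gV :- φVx))) ≈-refl
           ε r r₀ w (gain V x) (total (gain V) xs) (total φ xs) (total φ ys) (φ x) (φ (V x)))
      split-total ε φ φU φV {r₀} (p ∷ ps) (cut {w} {x} {xs} {r} {ys} s r+d≰0 0≰r) = ≈+nonneg⇒≤
        (+-nonneg (x≤y⇒0≤y-x (split-total ε φ φU φV ps s))
          (+-nonneg (*-nonneg μ-nonneg (x≤y⇒0≤y-x (φU x))) (*-nonneg w-μ-nonneg (x≤y⇒0≤y-x (φV x)))))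
        (begin
          T + w * φ x
            ≈⟨ solve 13 (λ ε r r₀ w μ gU gV t T T′ φx φUx φVx →
                 T :+ w :* φx :=
                 T′ :+ (w :- μ) :* φVx :+ μ :* φUx :+ ε :* ((r :+ μ :* (gU :+ gV)) :- r₀ :- (t :+ w :* gV)) :+
                 (T :- (T′ :+ ε :* (r :- r₀ :- t)) :+
                  (μ :* (φx :- (φUx :+ ε :* gU)) :+ (w :- μ) :* (φx :+ ε :* gV :- φVx)))) ≈-refl
                 ε r r₀ w μ (gain U x) (gain V x) t T T′ (φ x) (φ (U x)) (φ (V x)) ⟩
          rest (r + μ * (gain U x + gain V x))
            ≈⟨ +-congʳ (+-congˡ (*-congˡ (+-congʳ (+-congʳ r+μg≈0)))) ⟩
          rest 0#  ∎)
        where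
        open Cut {w} {x} {r} p r+d≰0 0≰r
        t T T′ : Carrier
        t  = total (gain V) xs
        T = total φ xs
        T′ = total φ ys
        rest : Carrier → Carrier
        rest z = T′ + (w - μ) * φ (V x) + μ * φ (U x) + ε * (z - r₀ - (t + w * gain V x)) +
                 (T - (T′ + ε * (r - r₀ - t)) +
                  (μ * (φ x - (φ (U x) + ε * gain U x)) + (w - μ) * (φ x + ε * gain V x - φ (V x))))
        r+μg≈0 : r + μ * (gain U x + gain V x) ≈ 0#
        r+μg≈0 = ≈-trans (+-congˡ μ-gains) (-‿inverseʳ r)

    split-all : ∀ {p q} {P : X → Set p} {Q : X → Set q} →
                (∀ {x} → P x → Q (U x)) → (∀ {x} → P x → Q (V x)) →
                ∀ {r₀ xs r ys} → Split r₀ xs r ys → All (λ (_ , x) → P x) xs → All (λ (_ , x) → Q x) ys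
    split-all PU PV done        []       = []
    split-all PU PV (toU s _)   (p ∷ ps) = PU p ∷ split-all PU PV s ps
    split-all PU PV (toV s _)   (p ∷ ps) = PV p ∷ split-all PU PV s ps
    split-all PU PV (cut s _ _) (p ∷ ps) = PU p ∷ PV p ∷ split-all PU PV s ps

    total-split-weight : ∀ φ → (∀ x → φ (U x) ≈ φ x) → (∀ x → φ (V x) ≈ φ x) →
                         ∀ {r₀ xs r ys} → Split r₀ xs r ys → total φ ys ≈ total φ xs
    total-split-weight φ φU φV done        = ≈-refl
    total-split-weight φ φU φV (toU {x = x} s _) = +-cong (total-split-weight φ φU φV s) (*-congˡ (φU x))
    total-split-weight φ φU φV (toV {x = x} s _) = +-cong (total-split-weight φ φU φV s) (*-congˡ (φV x))
    total-split-weight φ φU φV (cut {w} {x} {xs} {r} {ys} s _ _) = begin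
      total φ ys + (w - μ) * φ (V x) + μ * φ (U x)
        ≈⟨ +-cong (+-cong (total-split-weight φ φU φV s) (*-congˡ (φV x))) (*-congˡ (φU x)) ⟩
      total φ xs + (w - μ) * φ x + μ * φ x
        ≈⟨ solve 4 (λ t w μ y → t :+ (w :- μ) :* y :+ μ :* y := t :+ w :* y) ≈-refl (total φ xs) w μ (φ x) ⟩
      total φ xs + w * φ x  ∎
      where μ = firstShare w r x

-- The potential 2 f(X ∪ S) - f(X).

module Potential {c ℓ₁ ℓ₂} (ℝ : RealField c ℓ₁ ℓ₂) {u : Vec ℕ n}
                 (f : MultiSet u → RealField.Carrier ℝ)
                 (submodular : Problem.Submodular ℝ f) (monotone : Problem.Monotone ℝ f) where
  open RealField ℝ
  open OrderedField ℝ
  open Solver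
  open WeightedSplitting ℝ f public

  potential : MultiSet u → MultiSet u → Carrier
  potential S X = f (X ∪ S) + f (X ∪ S) - f X

  -- Diminishing returns, from submodularity of `f` at `X ∪ S` and `Y`. Their intersection may be
  -- larger than `X`, which monotonicity absorbs.
  ∪-f-≤ : ∀ {X Y S} → X ⊆ Y → f (Y ∪ S) + f X ≤ f (X ∪ S) + f Y
  ∪-f-≤ {X} {Y} {S} X⊆Y = ≤-trans
    (≤-respˡ-≈ (+-commutative _ _) (+-mono-≤
      (monotone X ((X ∪ S) ∩ Y) (∩-glb {X = X ∪ S} {Y} {X} (x⊆x∪y X S) X⊆Y))
      (monotone (Y ∪ S) ((X ∪ S) ∪ Y) (∪-lub {X = Y} {S} {(X ∪ S) ∪ Y} (y⊆x∪y (X ∪ S) Y)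
        (⊆-trans {X = S} {X ∪ S} {(X ∪ S) ∪ Y} (y⊆x∪y X S) (x⊆x∪y (X ∪ S) Y))))))
    (submodular (X ∪ S) Y)

  gain-nonneg : ∀ e X → 0# ≤ f (raise e X) - f X
  gain-nonneg e X = x≤y⇒0≤y-x (monotone X (raise e X) (raise-inflationary e X))

  -- The raised set stays inside `X ∪ S`, so the union does not grow and only the term `- f X`
  -- changes.
  raise-potential-⊨ : ∀ {S} e → toPoint S ⊨ e → ∀ X →
                      potential S (raise e X) + (f (raise e X) - f X) ≤ potential S X
  raise-potential-⊨ {S} e S⊨e X = ≈+nonneg⇒≤ (+-nonneg 0≤Δ 0≤Δ)
    (solve 4 (λ a b x r → a :+ a :- x := b :+ b :- r :+ (r :- x) :+ ((a :- b) :+ (a :- b))) ≈-refl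
       (f (X ∪ S)) (f (raise e X ∪ S)) (f X) (f (raise e X)))
    where
    X⊆X∪S = x⊆x∪y X S
    X∪S⊨e : toPoint (X ∪ S) ⊨ e
    X∪S⊨e = ℕ.≤-trans S⊨e (⊆-toPoints {X = S} {X ∪ S} (y⊆x∪y X S) (coord e))
    0≤Δ : 0# ≤ f (X ∪ S) - f (raise e X ∪ S)
    0≤Δ = x≤y⇒0≤y-x (monotone (raise e X ∪ S) (X ∪ S)
      (∪-lub {X = raise e X} {S} {X ∪ S} (raise-lub e {X} {X ∪ S} X⊆X∪S X∪S⊨e) (y⊆x∪y X S)))

  -- By diminishing returns the union gains at most what `X` gains. It counts twice, and the term
  -- `- f X` takes one gain back.
  raise-potential : ∀ S e X → potential S (raise e X) ≤ potential S X + (f (raise e X) - f X)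
  raise-potential S e X = ≈+nonneg⇒≤ (+-nonneg 0≤Δ 0≤Δ)
    (solve 4 (λ a b x r → a :+ a :- x :+ (r :- x) :=
                          b :+ b :- r :+ ((a :+ r :- (b :+ x)) :+ (a :+ r :- (b :+ x)))) ≈-refl
       (f (X ∪ S)) (f (raise e X ∪ S)) (f X) (f (raise e X)))
    where
    0≤Δ : 0# ≤ f (X ∪ S) + f (raise e X) - (f (raise e X ∪ S) + f X)
    0≤Δ = x≤y⇒0≤y-x (∪-f-≤ {X} {raise e X} {S} (raise-inflationary e X))

  module _ (e e′ : Literal u) {xs r ys} (nonneg : Nonneg xs)
           (split : Split (raise e) (raise e′) (- total (gain (raise e′)) xs) xs r ys) where

    private
      V≥0 = gain-nonneg e′
      U≥0 = gain-nonneg e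
      T : Carrier
      T = total (gain (raise e′)) xs

      T≥0 : ∀ {xs} → Nonneg xs → 0# ≤ total (gain (raise e′)) xs
      T≥0 []       = ≤-refl
      T≥0 (p ∷ ps) = +-nonneg (T≥0 ps) (*-nonneg p (V≥0 _))

      r≤0 : r ≤ 0#
      r≤0 = split-≤0 (raise e) (raise e′) U≥0 V≥0
        (≈+nonneg⇒≤ (T≥0 nonneg) (solve 1 (λ t → con (+ 0) := (:- t) :+ t) ≈-refl T)) split

      0≤r : 0# ≤ r
      0≤r with split-≥ (raise e) (raise e′) U≥0 V≥0 nonneg split
      ... | inj₁ 0≤r = 0≤r
      ... | inj₂ ≤r  = ≤-respˡ-≈ (solve 1 (λ t → (:- t) :+ t := con (+ 0)) ≈-refl T) ≤r

      -- The factor of `ε` in `split-total` is the total gain spent on `e` minus that spent on `e′`.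
      -- With the initial balance `- T` it equals `r`, which the preceding bounds squeeze to zero.
      balanced : ∀ ε → ε * (r - - T - T) ≈ 0#
      balanced ε = ≈-trans (solve 3 (λ ε r t → ε :* (r :- (:- t) :- t) := ε :* r) ≈-refl ε r T)
        (≈-trans (*-congˡ (≤-antisym r≤0 0≤r)) (zeroʳ ε))

      -1*x : ∀ x → - 1# * x ≈ - x
      -1*x x = ≈-trans (solve 2 (λ o x → (:- o) :* x := :- (o :* x)) ≈-refl 1# x) (-‿cong (*-identityˡ x))

      from-ε : ∀ ε {S} → total (potential S) ys + ε * (r - - T - T) ≤ total (potential S) xs →
               total (potential S) ys ≤ total (potential S) xs
      from-ε ε = ≤-respˡ-≈ (≈-trans (+-congˡ (balanced ε)) (+-identityʳ _))

    split-potential : ∀ {S} → toPoint S ⊨ e ⊎ toPoint S ⊨ e′ →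
                      total (potential S) ys ≤ total (potential S) xs
    split-potential {S} (inj₁ S⊨e) = from-ε 1# {S} (split-total (raise e) (raise e′) U≥0 V≥0 1# (potential S)
      (λ X → ≤-respˡ-≈ (+-congˡ (≈-sym (*-identityˡ _))) (raise-potential-⊨ {S} e S⊨e X))
      (λ X → ≤-respʳ-≈ (+-congˡ (≈-sym (*-identityˡ _))) (raise-potential S e′ X)) nonneg split)
    split-potential {S} (inj₂ S⊨e′) = from-ε (- 1#) {S} (split-total (raise e) (raise e′) U≥0 V≥0 (- 1#) (potential S)
      (λ X → ≈+nonneg⇒≤ (x≤y⇒0≤y-x (raise-potential S e X)) (≈-trans
        (solve 3 (λ p q g → q := p :- g :+ (q :+ g :- p)) ≈-refl
           (potential S (raise e X)) (potential S X) (f (raise e X) - f X))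
        (+-congʳ (+-congˡ (≈-sym (-1*x _))))))
      (λ X → ≈+nonneg⇒≤ (x≤y⇒0≤y-x (raise-potential-⊨ {S} e′ S⊨e′ X)) (≈-trans (+-congˡ (-1*x _))
        (solve 3 (λ p q g → q :+ :- g := p :+ (q :- (p :+ g))) ≈-refl
           (potential S (raise e′ X)) (potential S X) (f (raise e′ X) - f X))))
      nonneg split)

  fX≤potential : ∀ S X → f X ≤ potential S X
  fX≤potential S X = ≈+nonneg⇒≤ (+-nonneg 0≤Δ 0≤Δ)
    (solve 2 (λ a x → a :+ a :- x := x :+ ((a :- x) :+ (a :- x))) ≈-refl (f (X ∪ S)) (f X))
    where 0≤Δ = x≤y⇒0≤y-x (monotone X (X ∪ S) (x⊆x∪y X S))

  potential-≤ : ∀ {S X} → 0# ≤ f X → X ⊆ S → potential S X ≤ f S + f S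
  potential-≤ {S} {X} 0≤fX X⊆S = ≈+nonneg⇒≤ (+-nonneg 0≤fX (+-nonneg 0≤Δ 0≤Δ))
    (solve 3 (λ s a x → s :+ s := a :+ a :- x :+ (x :+ ((s :- a) :+ (s :- a)))) ≈-refl (f S) (f (X ∪ S)) (f X))
    where 0≤Δ = x≤y⇒0≤y-x (monotone (X ∪ S) S (∪-lub {X = X} {S} {S} X⊆S (Pointwise.refl ℕ.≤-refl)))

-- Running time

-- The variables are n, |A| and U.  The summands bound the numbers of
-- constraints, of rounds of propagation and of pairs of literals.
loopBound : +-*-Solver.Polynomial 3
loopBound = con 1 :+ var (Fin.suc Fin.zero) :+ k :+ k :* k
  where
  open +-*-Solver
  k : Polynomial 3
  k = var Fin.zero :* (con 1 :+ var (Fin.suc (Fin.suc Fin.zero)))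

module _ where
  open +-*-Solver using (Polynomial; con; _:+_; _:*_)

  -- Purely syntactic: both branches of a conditional are added up, and each loop body is charged
  -- `loopBound` times. One polynomial thus exists before any input is given, and it remains to show
  -- that no loop runs longer.
  cost : Γ ⊢ τ → Polynomial 3
  cost (var _)         = con 1
  cost (let′ t b)      = con 1 :+ (cost t :+ cost b)
  cost (call b t)      = con 1 :+ (cost t :+ cost b)
  cost (natLit _)      = con 1
  cost (boolLit _)     = con 1
  cost nil             = con 1
  cost (pair s t)      = con 1 :+ (cost s :+ cost t)
  cost (prim _ t)      = con 1 :+ cost t
  cost (if b s t)      = con 1 :+ (cost b :+ (cost s :+ cost t))
  cost (recℕ t z s)    = con 1 :+ (cost t :+ (cost z :+ loopBound :* cost s))
  cost (recList t z s) = con 1 :+ (cost t :+ (cost z :+ loopBound :* cost s))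

-- Code without loops meets its `cost` unconditionally, so `pure` asks for its value only. On a
-- concrete loop-free term this is a product of unit types, which is inferred.
LoopFree : Γ ⊢ τ → Set
LoopFree (var _)         = ⊤
LoopFree (let′ t b)      = LoopFree t × LoopFree b
LoopFree (call b t)      = LoopFree t × LoopFree b
LoopFree (natLit _)      = ⊤
LoopFree (boolLit _)     = ⊤
LoopFree nil             = ⊤
LoopFree (pair s t)      = LoopFree s × LoopFree t
LoopFree (prim _ t)      = LoopFree t
LoopFree (if b s t)      = LoopFree b × LoopFree s × LoopFree t
LoopFree (recℕ _ _ _)    = ⊥
LoopFree (recList _ _ _) = ⊥

-- A program logic with time bounds.

module Triples {c ℓ₁ ℓ₂} (ℝ : RealField c ℓ₁ ℓ₂)
               (value : List ℕ → RealField.Carrier ℝ) (ρ : Vec ℕ 3) where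
  open Semantics ℝ

  maxLoop : ℕ
  maxLoop = +-*-Solver.⟦ loopBound ⟧ ρ

  timeBound : Γ ⊢ τ → ℕ
  timeBound t = +-*-Solver.⟦ cost t ⟧ ρ

  -- A Hoare triple whose precondition is the concrete environment. As the time bound depends on the
  -- term alone, proofs about programs never mention time except to bound loop lengths.
  record Triple (t : Γ ⊢ τ) (γ : Env Γ) (Q : Val τ → Set q) : Set q where
    constructor triple
    field
      post : Q (proj₁ (eval value t γ))
      fast : proj₂ (eval value t γ) ℕ.≤ timeBound t

  open Triple public

  private
    variable
      γ : Env Γ

  weaken : {t : Γ ⊢ τ} {Q : Val τ → Set q} {R : Val τ → Set r} →
           Triple t γ Q → (∀ {v} → Q v → R v) → Triple t γ R
  weaken (triple p f) Q⇒R = triple (Q⇒R p) f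

  loopFree-fast : (t : Γ ⊢ τ) → LoopFree t → (γ : Env Γ) →
                  proj₂ (eval value t γ) ℕ.≤ timeBound t
  loopFree-fast (var x)     _        γ = s≤s z≤n
  loopFree-fast (let′ t b)  (p , q)  γ = s≤s (ℕ.+-mono-≤ (loopFree-fast t p γ) (loopFree-fast b q _))
  loopFree-fast (call b t)  (p , q)  γ = s≤s (ℕ.+-mono-≤ (loopFree-fast t p γ) (loopFree-fast b q _))
  loopFree-fast (natLit m)  _        γ = s≤s z≤n
  loopFree-fast (boolLit b) _        γ = s≤s z≤n
  loopFree-fast nil         _        γ = s≤s z≤n
  loopFree-fast (pair s t)  (p , q)  γ = s≤s (ℕ.+-mono-≤ (loopFree-fast s p γ)
    (ℕ.≤-trans (ℕ.≤-reflexive (ℕ.+-identityʳ _)) (loopFree-fast t q γ)))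
  loopFree-fast (prim f t)  p        γ = s≤s (ℕ.≤-trans (ℕ.≤-reflexive (ℕ.+-identityʳ _)) (loopFree-fast t p γ))
  loopFree-fast (if b s t) (p , q , r) γ with lower (proj₁ (step value b γ)) | loopFree-fast b p γ
  ... | true  | m≤ = s≤s (ℕ.+-mono-≤ m≤ (ℕ.≤-trans (loopFree-fast s q γ) (ℕ.m≤m+n _ _)))
  ... | false | m≤ = s≤s (ℕ.+-mono-≤ m≤ (ℕ.≤-trans (loopFree-fast t r γ) (ℕ.m≤n+m _ _)))

  pure : {t : Γ ⊢ τ} {lf : LoopFree t} {Q : Val τ → Set q} →
         Q (proj₁ (eval value t γ)) → Triple t γ Q
  pure {γ = γ} {t} {lf} p = triple p (loopFree-fast t lf γ)

  let-rule : {t : Γ ⊢ σ} {b : σ ∷ Γ ⊢ τ} {Q : Val σ → Set q} {R : Val τ → Set r} →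
              Triple t γ Q →
             (∀ {v} → Q v → Triple b (v ∷ γ) R) → Triple (let′ t b) γ R
  let-rule (triple p f) k = triple (post (k p)) (s≤s (ℕ.+-mono-≤ f (fast (k p))))

  call-rule : {b : σ ∷ [] ⊢ τ} {t : Γ ⊢ σ} {Q : Val σ → Set q} {R : Val τ → Set r} →
              Triple t γ Q →
              (∀ {v} → Q v → Triple b (v ∷ []) R) → Triple (call b t) γ R
  call-rule (triple p f) k = triple (post (k p)) (s≤s (ℕ.+-mono-≤ f (fast (k p))))

  prim-rule : {p : Prim σ τ} {t : Γ ⊢ σ} {R : Val τ → Set r} →
              Triple t γ (λ v → R (applyPrim value p v)) → Triple (prim p t) γ R
  prim-rule (triple p f) = triple p (s≤s (ℕ.≤-trans (ℕ.≤-reflexive (ℕ.+-identityʳ _)) f))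

  pair-rule : {s : Γ ⊢ σ} {t : Γ ⊢ τ} {Q : Val σ → Set q} {R : Val (σ ⊗ τ) → Set r} → Triple s γ Q →
              (∀ {x} → Q x → Triple t γ (λ y → R (x , y))) → Triple (pair s t) γ R
  pair-rule (triple p f) k = triple (post (k p))
    (s≤s (ℕ.+-mono-≤ f (ℕ.≤-trans (ℕ.≤-reflexive (ℕ.+-identityʳ _)) (fast (k p)))))

  private
    branch : ∀ {p a} {A : Set a} {P : Set p} {x} {s t : Timed A} {R : A → Set r} {j k} →
             Reflects P x →
             (P → R (proj₁ s) × proj₂ s ℕ.≤ j) → (¬ P → R (proj₁ t) × proj₂ t ℕ.≤ k) →
             R (proj₁ (if x then s else t)) × proj₂ (if x then s else t) ℕ.≤ j ℕ.+ k
    branch (ofʸ  p) yes′ _ with yes′ p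
    ... | pr , m≤ = pr , ℕ.≤-trans m≤ (ℕ.m≤m+n _ _)
    branch (ofⁿ ¬p) _ no′ with no′ ¬p
    ... | pr , m≤ = pr , ℕ.≤-trans m≤ (ℕ.m≤n+m _ _)

  if-rule : ∀ {p} {P : Set p} {b : Γ ⊢ bool} {s t : Γ ⊢ τ} {R : Val τ → Set r} →
            Triple b γ (λ v → Reflects P (lower v)) →
            (P → Triple s γ R) → (¬ P → Triple t γ R) → Triple (if b s t) γ R
  if-rule {R = R} (triple p m≤) yes′ no′ = triple (proj₁ result) (s≤s (ℕ.+-mono-≤ m≤ (proj₂ result)))
    where result = branch {R = R} p (λ p → post (yes′ p) , fast (yes′ p)) (λ ¬p → post (no′ ¬p) , fast (no′ ¬p))

  recℕ-rule : {t : Γ ⊢ nat} {z : Γ ⊢ τ} {s : nat ∷ τ ∷ Γ ⊢ τ}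
              {m : ℕ} (P : ℕ → Val τ → Set q) → m ℕ.≤ maxLoop →
              Triple t γ (_≡ lift m) → Triple z γ (P 0) →
              (∀ k {v} → k ℕ.< m → P k v → Triple s (lift k ∷ v ∷ γ) (P (suc k))) →
              Triple (recℕ t z s) γ (P m)
  recℕ-rule {τ = τ} {γ = γ} {t} {z} {s} {m} P m≤ (triple p₀ f) (triple p g) h =
    triple (proj₁ result)
      (s≤s (ℕ.+-mono-≤ f (ℕ.≤-trans (proj₂ result)
        (ℕ.+-monoʳ-≤ (timeBound z) (ℕ.*-monoˡ-≤ (timeBound s) m≤)))))
    where
    loop : ℕ → Timed (Val τ)
    loop = iterℕ (eval value z γ) (λ k v → eval value s (lift k ∷ v ∷ γ))
    go : ∀ k → k ℕ.≤ m → P k (proj₁ (loop k)) ×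
                         proj₂ (loop k) ℕ.≤ timeBound z ℕ.+ k ℕ.* timeBound s
    go zero    _   = p , ℕ.≤-trans g (ℕ.m≤m+n _ _)
    go (suc k) k<m with go k (ℕ.<⇒≤ k<m)
    ... | pk , fk = post body , (begin
      proj₂ (loop k) ℕ.+ _                                      ≤⟨ ℕ.+-mono-≤ fk (fast body) ⟩
      timeBound z ℕ.+ k ℕ.* timeBound s ℕ.+ timeBound s         ≡⟨ ℕ.+-assoc (timeBound z) _ _ ⟩
      timeBound z ℕ.+ (k ℕ.* timeBound s ℕ.+ timeBound s)       ≡⟨ cong (timeBound z ℕ.+_) (ℕ.+-comm _ (timeBound s)) ⟩
      timeBound z ℕ.+ suc k ℕ.* timeBound s                     ∎)
      where
      open ℕ.≤-Reasoning
      body = h k k<m pk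
    result = subst (λ v → P m (proj₁ (loop (lower v))) ×
                          proj₂ (loop (lower v)) ℕ.≤ timeBound z ℕ.+ m ℕ.* timeBound s)
                   (sym p₀) (go m ℕ.≤-refl)

  -- The program list is an image `map e ys`, so that invariants can speak of the mathematical
  -- objects `ys`. The loop is a right fold: `P ys′` concerns the suffix already processed, and its
  -- length is handed to the body to bound loops inside.
  recList-rule-≤ : ∀ {a} {A : Set a} {t : Γ ⊢ list σ} {z : Γ ⊢ τ}
                 {s : σ ∷ list σ ∷ τ ∷ Γ ⊢ τ} (e : A → Val σ) (ys : List A)
                 (P : List A → Val τ → Set q) → length ys ℕ.≤ maxLoop →
                 Triple t γ (_≡ map e ys) → Triple z γ (P []) →
                 (∀ y ys′ {v} → suc (length ys′) ℕ.≤ length ys → P ys′ v → Triple s (e y ∷ map e ys′ ∷ v ∷ γ) (P (y ∷ ys′))) →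
                 Triple (recList t z s) γ (P ys)
  recList-rule-≤ {γ = γ} {t = t} {z = z} {s = s} e ys P ys≤ (triple p₀ f) (triple p g) h =
    triple (proj₁ result)
      (s≤s (ℕ.+-mono-≤ f (ℕ.≤-trans (proj₂ result)
        (ℕ.+-monoʳ-≤ (timeBound z) (ℕ.*-monoˡ-≤ (timeBound s) ys≤)))))
    where
    loop = iterList (eval value z γ) (λ x xs v → eval value s (x ∷ xs ∷ v ∷ γ))
    go : ∀ ys′ → length ys′ ℕ.≤ length ys → P ys′ (proj₁ (loop (map e ys′))) ×
                proj₂ (loop (map e ys′)) ℕ.≤ timeBound z ℕ.+ length ys′ ℕ.* timeBound s
    go []       _ = p , ℕ.≤-trans g (ℕ.m≤m+n _ _)
    go (y ∷ ys) ys≤ with go ys (ℕ.<⇒≤ ys≤)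
    ... | pk , fk = post body , (begin
      proj₂ (loop (map e ys)) ℕ.+ _                                   ≤⟨ ℕ.+-mono-≤ fk (fast body) ⟩
      timeBound z ℕ.+ length ys ℕ.* timeBound s ℕ.+ timeBound s       ≡⟨ ℕ.+-assoc (timeBound z) _ _ ⟩
      timeBound z ℕ.+ (length ys ℕ.* timeBound s ℕ.+ timeBound s)     ≡⟨ cong (timeBound z ℕ.+_) (ℕ.+-comm _ (timeBound s)) ⟩
      timeBound z ℕ.+ suc (length ys) ℕ.* timeBound s                 ∎)
      where
      open ℕ.≤-Reasoning
      body = h y ys ys≤ pk
    result = subst (λ v → P ys (proj₁ (loop v)) ×
                          proj₂ (loop v) ℕ.≤ timeBound z ℕ.+ length ys ℕ.* timeBound s)
                   (sym p₀) (go ys ℕ.≤-refl)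

  recList-rule : ∀ {a} {A : Set a} {t : Γ ⊢ list σ} {z : Γ ⊢ τ}
                 {s : σ ∷ list σ ∷ τ ∷ Γ ⊢ τ} (e : A → Val σ) (ys : List A)
                 (P : List A → Val τ → Set q) → length ys ℕ.≤ maxLoop →
                 Triple t γ (_≡ map e ys) → Triple z γ (P []) →
                 (∀ y ys′ {v} → P ys′ v → Triple s (e y ∷ map e ys′ ∷ v ∷ γ) (P (y ∷ ys′))) →
                 Triple (recList t z s) γ (P ys)
  recList-rule e ys P ys≤ tr tz ts = recList-rule-≤ e ys P ys≤ tr tz (λ y ys′ _ → ts y ys′)

-- The program

pattern v0  = var (here refl)
pattern v1  = var (there (here refl))
pattern v2  = var (there (there (here refl)))
pattern v3  = var (there (there (there (here refl))))
pattern v4  = var (there (there (there (there (here refl)))))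
pattern v5  = var (there (there (there (there (there (here refl))))))
pattern v6  = var (there (there (there (there (there (there (here refl)))))))
pattern v7  = var (there (there (there (there (there (there (there (here refl))))))))
pattern v8  = var (there (there (there (there (there (there (there (there (here refl)))))))))
pattern v9  = var (there (there (there (there (there (there (there (there (there (here refl))))))))))

infixr 5 _,′_
_,′_ : Γ ⊢ σ → Γ ⊢ τ → Γ ⊢ σ ⊗ τ
_,′_ = pair

π₁ : Γ ⊢ σ ⊗ τ → Γ ⊢ σ
π₁ = prim fst

π₂ : Γ ⊢ σ ⊗ τ → Γ ⊢ τ
π₂ = prim snd

infixr 5 _∷′_
_∷′_ : Γ ⊢ σ → Γ ⊢ list σ → Γ ⊢ list σ
x ∷′ xs = prim cons (pair x xs)

infix  4 _≤ⁿ_ _≤ʳ_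
infixl 6 _+ⁿ_ _+ʳ_ _-ʳ_
infixl 7 _*ʳ_

_+ⁿ_ : Γ ⊢ nat → Γ ⊢ nat → Γ ⊢ nat
s +ⁿ t = prim addℕ (pair s t)

_≤ⁿ_ : Γ ⊢ nat → Γ ⊢ nat → Γ ⊢ bool
s ≤ⁿ t = prim leqℕ (pair s t)

_+ʳ_ _*ʳ_ _-ʳ_ : Γ ⊢ real → Γ ⊢ real → Γ ⊢ real
s +ʳ t = prim addℝ (pair s t)
s *ʳ t = prim mulℝ (pair s t)
s -ʳ t = s +ʳ prim negℝ t

_≤ʳ_ : Γ ⊢ real → Γ ⊢ real → Γ ⊢ bool
s ≤ʳ t = prim leqℝ (pair s t)

numeral : ℕ → Γ ⊢ real
numeral m = prim natToReal (natLit m)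

_≡ⁿ_ : Γ ⊢ nat → Γ ⊢ nat → Γ ⊢ bool
s ≡ⁿ t = if (s ≤ⁿ t) (t ≤ⁿ s) (boolLit false)

mapT : Γ ⊢ list σ → σ ∷ list σ ∷ list τ ∷ Γ ⊢ τ → Γ ⊢ list τ
mapT xs t = recList xs nil (t ∷′ v2)

-- The entry at an index counted from 0; d is the value beyond the end.
lookupT : Γ ⊢ τ → Γ ⊢ nat → Γ ⊢ list τ → Γ ⊢ τ
lookupT d k xs = recList (recℕ k xs (recList v1 nil v1)) d v0

natPair : Ty
natPair = nat ⊗ nat

constraint : Ty
constraint = nat ⊗ nat ⊗ real ⊗ real ⊗ real

atom : Ty
atom = real ⊗ list nat

0,0 : Γ ⊢ natPair
0,0 = natLit 0 ,′ natLit 0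

-- The programs below that run through all coordinates receive the list
-- 0 , … , n − 1 as their first argument.

-- Replaces the entry at the second argument by the third one.
setT : (∀ {Γ} → Γ ⊢ τ) → (list nat ⊗ nat ⊗ τ ⊗ list τ) ∷ [] ⊢ list τ
setT d = mapT (π₁ v0)
  (if (v0 ≡ⁿ π₁ (π₂ v3)) (π₁ (π₂ (π₂ v3))) (lookupT d v0 (π₂ (π₂ (π₂ v3)))))

cornerT : (constraint ⊗ list natPair) ∷ [] ⊢ bool
cornerT =
  let′ (lookupT 0,0 (π₁ (π₁ v0)) (π₂ v0))
  (let′ (lookupT 0,0 (π₁ (π₂ (π₁ v1))) (π₂ v1))
  (if (test (π₁ v1) (π₁ v0)) (boolLit true)
  (if (test (π₁ v1) (π₂ v0)) (boolLit true)
  (if (test (π₂ v1) (π₁ v0)) (boolLit true)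
      (test (π₂ v1) (π₂ v0))))))
  where
  test : σ ∷ τ ∷ (constraint ⊗ list natPair) ∷ [] ⊢ nat → σ ∷ τ ∷ (constraint ⊗ list natPair) ∷ [] ⊢ nat →
         σ ∷ τ ∷ (constraint ⊗ list natPair) ∷ [] ⊢ bool
  test x y = π₂ (π₂ abc) ≤ʳ π₁ abc *ʳ prim natToReal x +ʳ π₁ (π₂ abc) *ʳ prim natToReal y
    where abc = π₂ (π₂ (π₁ v2))

consistentT : (list constraint ⊗ list natPair) ∷ [] ⊢ bool
consistentT = recList (π₁ v0) (boolLit true)
  (if (call cornerT (v0 ,′ π₂ v3)) v2 (boolLit false))

tightenT : (list nat ⊗ list constraint ⊗ list natPair) ∷ [] ⊢ list natPair
tightenT = mapT (π₁ v0)
  (let′ (lookupT 0,0 v0 (π₂ (π₂ v3)))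
  (let′ (call (setT 0,0) (π₁ v4 ,′ v1 ,′ (π₁ v0 ,′ π₁ v0) ,′ π₂ (π₂ v4)))
  (let′ (call consistentT (π₁ (π₂ v5) ,′ v0))
  (let′ (call (setT 0,0) (π₁ v6 ,′ v3 ,′ (π₂ v2 ,′ π₂ v2) ,′ π₂ (π₂ v6)))
  (let′ (call consistentT (π₁ (π₂ v7) ,′ v0))
  (if v2 (π₁ v4) (natLit 1 +ⁿ π₁ v4) ,′
   if v0 (π₂ v4) (prim monusℕ (π₂ v4 ,′ natLit 1))))))))

-- The natural number is the number of rounds of propagation.
feasibleBelowT : (list nat ⊗ nat ⊗ list constraint ⊗ list nat) ∷ [] ⊢ bool
feasibleBelowT =
  let′ (mapT (π₂ (π₂ (π₂ v0))) (natLit 0 ,′ v0))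
  (let′ (recℕ (π₁ (π₂ v1)) v0 (call tightenT (π₁ v3 ,′ π₁ (π₂ (π₂ v3)) ,′ v1)))
  (recList v0 (boolLit true) (if (π₁ v0 ≤ⁿ π₂ v0) v2 (boolLit false))))

-- Sends (i , p) and x to x with xᵢ replaced by max xᵢ (p + 1).
raiseT : (list nat ⊗ natPair ⊗ list nat) ∷ [] ⊢ list nat
raiseT =
  let′ (lookupT (natLit 0) (π₁ (π₁ (π₂ v0))) (π₂ (π₂ v0)))
  (call (setT (natLit 0)) (π₁ v1 ,′ π₁ (π₁ (π₂ v1)) ,′
    if (v0 ≤ⁿ π₂ (π₁ (π₂ v1))) (natLit 1 +ⁿ π₂ (π₁ (π₂ v1))) v0 ,′ π₂ (π₂ v1)))

-- Sends (i , p) and x to x with xᵢ replaced by min xᵢ p.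
capT : (list nat ⊗ natPair ⊗ list nat) ∷ [] ⊢ list nat
capT =
  let′ (lookupT (natLit 0) (π₁ (π₁ (π₂ v0))) (π₂ (π₂ v0)))
  (call (setT (natLit 0)) (π₁ v1 ,′ π₁ (π₁ (π₂ v1)) ,′
    if (v0 ≤ⁿ π₂ (π₁ (π₂ v1))) v0 (π₂ (π₁ (π₂ v1))) ,′ π₂ (π₂ v1)))

splitArgs : Ty
splitArgs = list nat ⊗ natPair ⊗ natPair ⊗ list atom

-- Only the second literal matters here.
totalGainT : splitArgs ∷ [] ⊢ real
totalGainT = recList (π₂ (π₂ (π₂ v0))) (numeral 0)
  (let′ (call raiseT (π₁ v3 ,′ π₁ (π₂ (π₂ v3)) ,′ π₂ v0))
  (let′ (prim oracle (π₂ v1))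
  (let′ (prim oracle v1)
  (v5 +ʳ π₁ v3 *ʳ (v0 -ʳ v1)))))

splitT : splitArgs ∷ [] ⊢ list atom
splitT =
  let′ (call totalGainT v0)
  (π₂ (recList (π₂ (π₂ (π₂ v1))) (prim negℝ v0 ,′ nil)
    (let′ (call raiseT (π₁ v4 ,′ π₁ (π₂ v4) ,′ π₂ v0))
    (let′ (call raiseT (π₁ v5 ,′ π₁ (π₂ (π₂ v5)) ,′ π₂ v1))
    (let′ (prim oracle (π₂ v2))
    (let′ (prim oracle v2)
    (let′ (prim oracle v2)
    (let′ (π₁ v5 *ʳ ((v1 -ʳ v2) +ʳ (v0 -ʳ v2)))
    -- Sets go to the first literal while the balance stays at most zero, and to the second one once
    -- it is nonnegative. In the remaining case the balance would cross zero, so `v0` is nonzero and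
    -- may be inverted.
    (if (π₁ v8 +ʳ v0 ≤ʳ numeral 0)
      (π₁ v8 +ʳ v0 ,′ ((π₁ v6 ,′ v5) ∷′ π₂ v8))
    (if (numeral 0 ≤ʳ π₁ v8)
      (π₁ v8 ,′ ((π₁ v6 ,′ v4) ∷′ π₂ v8))
    (let′ (π₁ v6 *ʳ (prim negℝ (π₁ v8) *ʳ prim invℝ v0))
      (numeral 0 ,′ ((v0 ,′ v6) ∷′ (π₁ v7 -ʳ v0 ,′ v5) ∷′ π₂ v9)))))))))))))

inputTy : Ty
inputTy = list nat ⊗ list constraint

-- The number n is given only as the length of a list. Each entry of that list shifts the indices
-- found so far and puts 0 in front.
indicesT : inputTy ∷ [] ⊢ list nat
indicesT = recList (π₁ v0) nil (natLit 0 ∷′ mapT v2 (natLit 1 +ⁿ v0))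

-- The width of the box below `u`. It bounds the width below any smaller point, so one number of
-- rounds serves all feasibility tests.
roundsT : inputTy ∷ [] ⊢ nat
roundsT = recList (π₁ v0) (natLit 0) ((natLit 1 +ⁿ v0) +ⁿ v2)

literalsT : (list nat ⊗ list nat) ∷ [] ⊢ list natPair
literalsT = recList (π₁ v0) nil
  (recℕ (lookupT (natLit 0) v0 (π₂ v3)) v2 ((v2 ,′ v0) ∷′ v1))

-- The indices, the number of rounds, all literals and the input.
globals : Ty
globals = list nat ⊗ nat ⊗ list natPair ⊗ inputTy

-- Capping `u` at both literals gives the largest point violating both. A feasible point below it
-- refutes the clause, and the family is then left as it is.
clauseT : (globals ⊗ natPair ⊗ natPair ⊗ list atom) ∷ [] ⊢ list atom
clauseT =
  let′ (π₁ v0)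
  (let′ (π₂ v1)
  (let′ (call capT (π₁ v1 ,′ π₁ v0 ,′ π₁ (π₂ (π₂ (π₂ v1)))))
  (let′ (call capT (π₁ v2 ,′ π₁ (π₂ v1) ,′ v0))
  (if (call feasibleBelowT (π₁ v3 ,′ π₁ (π₂ v3) ,′ π₂ (π₂ (π₂ (π₂ v3))) ,′ v0))
    (π₂ (π₂ v2))
    (call splitT (π₁ v3 ,′ v2))))))

coverT : globals ∷ [] ⊢ list atom
coverT =
  let′ (mapT (π₁ v0) (natLit 0))
  (recList (π₁ (π₂ (π₂ v1))) ((numeral 1 ,′ v0) ∷′ nil)
    (recList (π₁ (π₂ (π₂ v4))) v2
      (call clauseT (v7 ,′ v3 ,′ v0 ,′ v2))))

-- The fold starts from `u`. This point satisfies every clause, so it is acceptable should it be the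
-- one returned.
cheapestT : (list nat ⊗ list atom) ∷ [] ⊢ list nat
cheapestT = recList (π₂ v0) (π₁ v0)
  (let′ (prim oracle (π₂ v0))
  (let′ (prim oracle v3)
  (if (v1 ≤ʳ v0) (π₂ v2) v4)))

-- Each cap is kept if a feasible point survives it. One pass is enough, because a cap once refused
-- would be refused again below a smaller bound.
minimiseT : (globals ⊗ list nat) ∷ [] ⊢ list nat
minimiseT = recList (π₁ (π₂ (π₂ (π₁ v0)))) (π₂ v0)
  (let′ (π₁ v3)
  (let′ (call capT (π₁ v0 ,′ v1 ,′ v3))
  (if (call feasibleBelowT (π₁ v1 ,′ π₁ (π₂ v1) ,′ π₂ (π₂ (π₂ (π₂ v1))) ,′ v0)) v0 v4)))

algorithm : inputTy ∷ [] ⊢ list nat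
algorithm =
  let′ (call indicesT v0)
  (let′ (call roundsT v1)
  (let′ (call literalsT (v1 ,′ π₁ v2))
  (let′ (v2 ,′ v1 ,′ v0 ,′ v3)
  (let′ (call coverT v0)
  (let′ (call cheapestT (π₁ v5 ,′ v0))
  (call minimiseT (v2 ,′ v0)))))))

-- Correctness of the program

drop-suc : ∀ {a} {A : Set a} m (xs : List A) → drop 1 (drop m xs) ≡ drop (suc m) xs
drop-suc zero    xs       = refl
drop-suc (suc m) []       = refl
drop-suc (suc m) (_ ∷ xs) = drop-suc m xs

head-drop-tabulate : ∀ {a} {A : Set a} {n} (g : Fin n → A) i → head (drop (toℕ i) (tabulate g)) ≡ just (g i)
head-drop-tabulate g Fin.zero    = refl
head-drop-tabulate g (Fin.suc i) = head-drop-tabulate (g ∘ Fin.suc) i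

length-allFin : ∀ n → length (allFin n) ≡ n
length-allFin n = List.length-tabulate {n = n} (λ i → i)

Reflects-map : ∀ {p q} {P : Set p} {Q : Set q} {b} → (P → Q) → (Q → P) → Reflects P b → Reflects Q b
Reflects-map f g (ofʸ  p) = ofʸ (f p)
Reflects-map f g (ofⁿ ¬p) = ofⁿ (¬p ∘ g)

proof : ∀ {p} {P : Set p} (d : Dec P) → Reflects P (does d)
proof (_ because r) = r

toList-array : ∀ {a} {A : Set a} {m} (v : Vec A m) → map (lookup v) (allFin m) ≡ toList v
toList-array v = trans (List.map-tabulate (λ k → k) (lookup v)) (go v)
  where
  go : ∀ {a} {A : Set a} {m} (v : Vec A m) → tabulate (lookup v) ≡ toList v
  go []      = refl
  go (x ∷ v) = cong (x ∷_) (go v)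

pad-toList : ∀ {m} (v : Vec ℕ m) → pad m (toList v) ≡ v
pad-toList []      = refl
pad-toList (x ∷ v) = cong (x ∷_) (pad-toList v)

zipWith-⊓-≤ : ∀ {m} (v w : Vec ℕ m) → (∀ k → lookup v k ℕ.≤ lookup w k) → Vec.zipWith ℕ._⊓_ v w ≡ v
zipWith-⊓-≤ []      []      _   = refl
zipWith-⊓-≤ (x ∷ v) (y ∷ w) v≤w = cong₂ _∷_ (ℕ.m≤n⇒m⊓n≡m (v≤w Fin.zero)) (zipWith-⊓-≤ v w (v≤w ∘ Fin.suc))

query-toList : ∀ {m} {u : Vec ℕ m} (X : MultiSet u) → query u (toList (mult X)) ≡ X
query-toList {u = u} X = mult-injective {X = query u (toList (mult X))} {X}
  (trans (cong (λ v → Vec.zipWith ℕ._⊓_ v u) (pad-toList (mult X))) (zipWith-⊓-≤ (mult X) u (toPoint-≤ X)))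

module Correctness {c ℓ₁ ℓ₂} (ℝ : RealField c ℓ₁ ℓ₂) {n : ℕ} (P : Problem.SM2Multi ℝ n) where
  open RealField ℝ
  open Problem ℝ
  open SM2Multi P
  open Semantics ℝ
  open TwoVariableConstraints ℝ A
  open Constraint

  oracleValue : List ℕ → Carrier
  oracleValue xs = f (query u xs)

  sizes : Vec ℕ 3
  sizes = n ∷ length A ∷ U ∷ []

  open Triples ℝ oracleValue sizes

  private
    variable
      γ : Env Γ

  array : ∀ {a} {A : Set a} → (Fin n → A) → List A
  array g = map g (allFin n)

  nats : Point n → List (Lift c ℕ)
  nats s = array (lift ∘ s)

  n≤maxLoop : n ℕ.≤ maxLoop
  n≤maxLoop = begin
    n                           ≡⟨ ℕ.*-identityʳ n ⟨
    n ℕ.* 1                     ≤⟨ ℕ.*-monoʳ-≤ n (s≤s z≤n) ⟩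
    n ℕ.* (1 ℕ.+ U)             ≤⟨ ℕ.m≤n+m _ (1 ℕ.+ length A) ⟩
    1 ℕ.+ length A ℕ.+ n ℕ.* (1 ℕ.+ U)  ≤⟨ ℕ.m≤m+n _ _ ⟩
    maxLoop                     ∎
    where open ℕ.≤-Reasoning

  length-allFin-≤ : length (allFin n) ℕ.≤ maxLoop
  length-allFin-≤ = subst (ℕ._≤ maxLoop) (sym (length-allFin n)) n≤maxLoop

  exact : {t : Γ ⊢ τ} {lf : LoopFree t} → Triple t γ (_≡ proj₁ (eval oracleValue t γ))
  exact {lf = lf} = pure {lf = lf} refl

  -- Dropping as many entries as the index says puts the wanted one in front, and a fold that
  -- discards its recursive result returns the head.
  lookup-triple : (g : Fin n → Val τ) (i : Fin n) {d : Γ ⊢ τ} {k : Γ ⊢ nat} {xs : Γ ⊢ list τ} →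
    {lf : LoopFree d} → Triple k γ (_≡ lift (toℕ i)) → Triple xs γ (_≡ array g) →
    Triple (lookupT d k xs) γ (_≡ g i)
  lookup-triple g i {lf = lf} tk txs =
    weaken (recList-rule g (drop (toℕ i) (allFin n)) (λ ys v → ∀ {y} → head ys ≡ just y → v ≡ g y)
      (length-drop (toℕ i))
      (recℕ-rule (λ m v → v ≡ map g (drop m (allFin n)))
        (ℕ.≤-trans (ℕ.<⇒≤ (Fin.toℕ<n i)) n≤maxLoop) tk txs
        λ { m _ refl → weaken
          (recList-rule g (drop m (allFin n)) (λ ys v → v ≡ map g (drop 1 ys)) (length-drop m)
            exact exact (λ { y ys refl → exact }))
          (λ { refl → cong (map g) (drop-suc m (allFin n)) }) })
      (pure {lf = lf} λ ())
      (λ { y ys _ → pure λ { refl → refl } }))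
    (λ h → h (head-drop-tabulate (λ i → i) i))
    where
    length-drop : ∀ m → length (drop m (allFin n)) ℕ.≤ maxLoop
    length-drop m = ℕ.≤-trans (ℕ.≤-reflexive (List.length-drop m (allFin n)))
                              (ℕ.≤-trans (ℕ.m∸n≤m _ m) length-allFin-≤)

  map-triple : ∀ {a} {A : Set a} (e : A → Val σ) (g : A → Val τ) (ys : List A) {t : Γ ⊢ list σ}
    {s : σ ∷ list σ ∷ list τ ∷ Γ ⊢ τ} → length ys ℕ.≤ maxLoop → Triple t γ (_≡ map e ys) →
    (∀ y {xs v} → Triple s (e y ∷ xs ∷ v ∷ γ) (_≡ g y)) → Triple (mapT t s) γ (_≡ map g ys)
  map-triple e g ys ys≤ tr ts = recList-rule e ys (λ ys v → v ≡ map g ys) ys≤ tr exact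
    λ { y ys′ refl → prim-rule (pair-rule (ts y) λ { refl → pure refl }) }

  ≤ⁿ-triple : ∀ {x y} {s t : Γ ⊢ nat} → Triple s γ (_≡ lift x) → Triple t γ (_≡ lift y) →
              Triple (s ≤ⁿ t) γ (λ v → Reflects (x ℕ.≤ y) (lower v))
  ≤ⁿ-triple {x = x} {y} ts tr = prim-rule (pair-rule ts λ { refl → weaken tr λ { refl → proof (x ℕ.≤? y) } })

  ≡ⁿ-triple : ∀ {x y} {s t : Γ ⊢ nat} → Triple s γ (_≡ lift x) → Triple t γ (_≡ lift y) →
              Triple (s ≡ⁿ t) γ (λ v → Reflects (x ≡ y) (lower v))
  ≡ⁿ-triple ts tr = if-rule (≤ⁿ-triple ts tr)
    (λ x≤y → weaken (≤ⁿ-triple tr ts) (Reflects-map (ℕ.≤-antisym x≤y) (ℕ.≤-reflexive ∘ sym)))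
    (λ x≰y → pure (ofⁿ (x≰y ∘ ℕ.≤-reflexive)))

  set-triple : (g g′ : Fin n → Val τ) (i : Fin n) {d : ∀ {Γ} → Γ ⊢ τ} {lf : ∀ {Γ} → LoopFree (d {Γ})} →
    (∀ k → k ≢ i → g′ k ≡ g k) →
    Triple (setT d) ((nats toℕ , lift (toℕ i) , g′ i , array g) ∷ []) (_≡ array g′)
  set-triple g g′ i {d} {lf} g′≡g = map-triple (lift ∘ toℕ) g′ (allFin n) length-allFin-≤ exact λ k →
    if-rule (≡ⁿ-triple exact exact)
      (λ k≡i → pure (cong g′ (sym (Fin.toℕ-injective k≡i))))
      (λ k≢i → weaken (lookup-triple g k {lf = lf} exact exact)
                 λ { refl → sym (g′≡g k (k≢i ∘ cong toℕ)) })

  boxEntry : ℕ × ℕ → Val natPair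
  boxEntry (l , h) = lift l , lift h

  boxes : Box n → Val (list natPair)
  boxes B = array (boxEntry ∘ B)

  encode : Constraint n → Val constraint
  encode C = lift (toℕ (i C)) , lift (toℕ (j C)) , aᵢⱼ C , bᵢⱼ C , cᵢⱼ C

  fix-triple : ∀ B k v → Triple (setT 0,0)
    ((nats toℕ , lift (toℕ k) , (lift v , lift v) , boxes B) ∷ []) (_≡ boxes (fix B k v))
  fix-triple B k v = subst (λ y → Triple (setT 0,0) ((nats toℕ , lift (toℕ k) , y , boxes B) ∷ []) (_≡ boxes (fix B k v)))
    (cong boxEntry (updateAt-updates k B))
    (set-triple (boxEntry ∘ B) (boxEntry ∘ fix B k v) k {d = 0,0} (λ l l≢k → cong boxEntry (updateAt-minimal l k B l≢k)))

  corner-triple : ∀ C B → Triple cornerT ((encode C , boxes B) ∷ []) (λ v → Reflects (Corner B C) (lower v))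
  corner-triple C B =
    let-rule (lookup-triple (boxEntry ∘ B) (i C) exact exact) λ { refl →
    let-rule (lookup-triple (boxEntry ∘ B) (j C) exact exact) λ { refl →
    if-rule (pure (proof (_ ≤? _))) (λ p → pure (ofʸ (inj₁ p))) λ ¬p →
    if-rule (pure (proof (_ ≤? _))) (λ q → pure (ofʸ (inj₂ (inj₁ q)))) λ ¬q →
    if-rule (pure (proof (_ ≤? _))) (λ r → pure (ofʸ (inj₂ (inj₂ (inj₁ r))))) λ ¬r →
    pure (Reflects-map (inj₂ ∘ inj₂ ∘ inj₂)
      (λ { (inj₁ p) → contradiction p ¬p ; (inj₂ (inj₁ q)) → contradiction q ¬q
         ; (inj₂ (inj₂ (inj₁ r))) → contradiction r ¬r ; (inj₂ (inj₂ (inj₂ s))) → s })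
      (proof (_ ≤? _))) } }

  |A|≤maxLoop : length A ℕ.≤ maxLoop
  |A|≤maxLoop = ℕ.≤-trans (ℕ.n≤1+n _) (ℕ.≤-trans (ℕ.m≤m+n _ _) (ℕ.m≤m+n _ _))

  consistent-triple : ∀ B → Triple consistentT ((map encode A , boxes B) ∷ []) (λ v → Reflects (Consistent B) (lower v))
  consistent-triple B = recList-rule encode A (λ Cs v → Reflects (All (Corner B) Cs) (lower v)) |A|≤maxLoop
    exact (pure (ofʸ [])) λ C Cs r →
    if-rule (call-rule exact λ { refl → corner-triple C B })
      (λ p → pure (Reflects-map (p ∷_) All.tail r))
      (λ ¬p → pure (ofⁿ (¬p ∘ All.head)))

  if-does-triple : ∀ {p} {P : Set p} (d : Dec P) {x y : ℕ} {b : Γ ⊢ bool} {s t : Γ ⊢ nat} →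
    Triple b γ (λ v → Reflects P (lower v)) → Triple s γ (_≡ lift x) → Triple t γ (_≡ lift y) →
    Triple (if b s t) γ (_≡ lift (if does d then x else y))
  if-does-triple d {x} {y} tb ts tr = if-rule tb
    (λ p  → weaken ts λ { refl → cong (λ b → lift (if b then x else y)) (sym (dec-true d p)) })
    (λ ¬p → weaken tr λ { refl → cong (λ b → lift (if b then x else y)) (sym (dec-false d ¬p)) })

  tighten-triple : ∀ B → Triple tightenT ((nats toℕ , map encode A , boxes B) ∷ []) (_≡ boxes (tighten B))
  tighten-triple B = map-triple (lift ∘ toℕ) (boxEntry ∘ tighten B) (allFin n) length-allFin-≤ exact λ k →
    let-rule (lookup-triple (boxEntry ∘ B) k exact exact) λ { refl →
    let-rule (call-rule exact λ { refl → fix-triple B k (lo B k) }) λ { refl →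
    let-rule (call-rule exact λ { refl → consistent-triple (fix B k (lo B k)) }) λ rlo →
    let-rule (call-rule exact λ { refl → fix-triple B k (hi B k) }) λ { refl →
    let-rule (call-rule exact λ { refl → consistent-triple (fix B k (hi B k)) }) λ rhi →
    pair-rule (if-does-triple (consistent? (fix B k (lo B k))) (pure rlo) exact exact) λ { refl →
    weaken (if-does-triple (consistent? (fix B k (hi B k))) (pure rhi) exact exact) λ { refl → refl } } } } }

  rounds : ℕ
  rounds = sum (map (suc ∘ lookup u) (allFin n))

  lookup≤U : ∀ {m} (v : Vec ℕ m) k → lookup v k ℕ.≤ Vec.foldr′ ℕ._⊔_ 0 v
  lookup≤U (x ∷ v) Fin.zero    = ℕ.m≤m⊔n x _
  lookup≤U (x ∷ v) (Fin.suc k) = ℕ.≤-trans (lookup≤U v k) (ℕ.m≤n⊔m x _)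

  sum-≤ : ∀ (g : Fin n → ℕ) {b} → (∀ k → g k ℕ.≤ b) → ∀ ks → sum (map g ks) ℕ.≤ length ks ℕ.* b
  sum-≤ g g≤b []       = z≤n
  sum-≤ g g≤b (k ∷ ks) = ℕ.+-mono-≤ (g≤b k) (sum-≤ g g≤b ks)

  rounds≤ : rounds ℕ.≤ n ℕ.* (1 ℕ.+ U)
  rounds≤ = subst (λ m → rounds ℕ.≤ m ℕ.* (1 ℕ.+ U)) (length-allFin n)
                  (sum-≤ (suc ∘ lookup u) (λ k → s≤s (lookup≤U u k)) (allFin n))

  rounds≤maxLoop : rounds ℕ.≤ maxLoop
  rounds≤maxLoop = ℕ.≤-trans rounds≤ (ℕ.≤-trans (ℕ.m≤n+m _ (1 ℕ.+ length A)) (ℕ.m≤m+n _ _))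

  feasibleBelow-triple : ∃ Feas → ∀ h → h ≤̇ lookup u → Triple feasibleBelowT
    ((nats toℕ , lift rounds , map encode A , nats h) ∷ []) (λ v → Reflects (FeasBelow h) (lower v))
  feasibleBelow-triple feasible h h≤u =
    let-rule (map-triple (lift ∘ h) (boxEntry ∘ below h) (allFin n) length-allFin-≤ exact λ k → exact) λ { refl →
    let-rule (recℕ-rule (λ m v → v ≡ boxes (propagate m (below h))) rounds≤maxLoop exact exact
      (λ { m _ refl → call-rule exact λ { refl → tighten-triple (propagate m (below h)) } })) λ { refl →
    weaken (recList-rule (boxEntry ∘ B) (allFin n) (λ ks v → Reflects (All (λ k → lo B k ℕ.≤ hi B k) ks) (lower v))
      length-allFin-≤ exact (pure (ofʸ []))
      λ k ks r → if-rule (≤ⁿ-triple exact exact)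
        (λ p → pure (Reflects-map (p ∷_) All.tail r))
        (λ ¬p → pure (ofⁿ (¬p ∘ All.head))))
    (Reflects-map
      (λ ne → propagation-complete rounds feasible (sum-mono-≤ (λ k → s≤s (h≤u k)) (allFin n))
                (λ k → All.lookup ne (∈-allFin k)))
      (λ feas → All.tabulate λ {k} _ → propagation-sound rounds feas k)) } }
    where
    B : Box n
    B = propagate rounds (below h)

-- Correctness of the algorithm and the factor 2.

module Approximation {c ℓ₁ ℓ₂} (ℝ : RealField c ℓ₁ ℓ₂) {n : ℕ} (P : Problem.SM2Multi ℝ n)
  (feasible : ∃ (Problem.SM2Multi.Feasible P)) (nonnegative : Problem.Nonnegative ℝ (Problem.SM2Multi.f P))
  (submodular : Problem.Submodular ℝ (Problem.SM2Multi.f P)) (monotone : Problem.Monotone ℝ (Problem.SM2Multi.f P)) where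
  open RealField ℝ
  open OrderedField ℝ
  open Problem ℝ
  open SM2Multi P
  open Semantics ℝ
  open TwoVariableConstraints ℝ A
  open Constraint
  open Correctness ℝ P
  open Triples ℝ oracleValue sizes
  open Potential ℝ f submodular monotone

  private
    variable
      γ : Env Γ

  feasiblePoint : ∃ Feas
  feasiblePoint = toPoint (proj₁ feasible) , proj₂ feasible

  literalValue : Literal u → Val natPair
  literalValue e = lift (toℕ (coord e)) , lift (level e)

  atomValue : Carrier × MultiSet u → Val atom
  atomValue (w , X) = w , nats (toPoint X)

  nats-cong : ∀ {s t} → s ≗ t → nats s ≡ nats t
  nats-cong s≗t = List.map-cong (cong lift ∘ s≗t) (allFin n)

  lower-nats : (X : MultiSet u) → map lower (nats (toPoint X)) ≡ toList (mult X)
  lower-nats X = trans (sym (List.map-∘ (allFin n))) (toList-array (mult X))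

  oracle-triple : ∀ X {t : Γ ⊢ list nat} → Triple t γ (_≡ nats (toPoint X)) → Triple (prim oracle t) γ (_≡ f X)
  oracle-triple X tr = prim-rule (weaken tr λ { refl →
    trans (cong (f ∘ query u) (lower-nats X)) (cong f (query-toList X)) })

  update-triple : ∀ (i : Fin n) (g : ℕ → ℕ) (s : Point n) {y : Γ ⊢ nat} {is k xs} →
    Triple is γ (_≡ nats toℕ) → Triple k γ (_≡ lift (toℕ i)) → Triple y γ (_≡ lift (g (s i))) → Triple xs γ (_≡ nats s) →
    Triple (call (setT (natLit 0)) (is ,′ k ,′ y ,′ xs)) γ (_≡ nats (updateAt s i g))
  update-triple i g s tis tk ty txs = call-rule {Q = _≡ input′ (updateAt s i g i)}
    (pair-rule tis λ { refl → pair-rule tk λ { refl → pair-rule ty λ { refl → weaken txs λ { refl →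
      cong input′ (sym (updateAt-updates i s)) } } } })
    λ { refl → set-triple (lift ∘ s) (lift ∘ updateAt s i g) i {d = natLit 0} (λ k k≢i → cong lift (updateAt-minimal k i s k≢i)) }
    where
    input′ : ℕ → Val (list nat ⊗ nat ⊗ nat ⊗ list nat)
    input′ m = nats toℕ , lift (toℕ i) , lift m , nats s

  raisePoint-triple : ∀ e s → Triple raiseT ((nats toℕ , literalValue e , nats s) ∷ []) (_≡ nats (raisePoint e s))
  raisePoint-triple e s =
    let-rule (lookup-triple (lift ∘ s) (coord e) exact exact) λ { refl →
    update-triple (coord e) (suc (level e) ℕ.⊔_) s exact exact
      (if-rule (≤ⁿ-triple exact exact)
        (λ s≤p → pure (cong lift (sym (ℕ.m≥n⇒m⊔n≡m (ℕ.m≤n⇒m≤1+n s≤p)))))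
        (λ s≰p → pure (cong lift (sym (ℕ.m≤n⇒m⊔n≡n (ℕ.≰⇒> s≰p))))))
      exact }

  capPoint-triple : ∀ e s → Triple capT ((nats toℕ , literalValue e , nats s) ∷ []) (_≡ nats (capPoint e s))
  capPoint-triple e s =
    let-rule (lookup-triple (lift ∘ s) (coord e) exact exact) λ { refl →
    update-triple (coord e) (level e ℕ.⊓_) s exact exact
      (if-rule (≤ⁿ-triple exact exact)
        (λ s≤p → pure (cong lift (sym (ℕ.m≥n⇒m⊓n≡n s≤p))))
        (λ s≰p → pure (cong lift (sym (ℕ.m≤n⇒m⊓n≡m (ℕ.<⇒≤ (ℕ.≰⇒> s≰p)))))))
      exact }

  raise-triple : ∀ e X → Triple raiseT ((nats toℕ , literalValue e , nats (toPoint X)) ∷ []) (_≡ nats (toPoint (raise e X)))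
  raise-triple e X = weaken (raisePoint-triple e (toPoint X))
    λ { refl → nats-cong (sym ∘ Vec.lookup∘tabulate (raisePoint e (toPoint X))) }

  splitInput : Literal u → Literal u → Weighted → Val splitArgs
  splitInput e e′ xs = nats toℕ , literalValue e , literalValue e′ , map atomValue xs

  totalGain-triple : ∀ e e′ xs → length xs ℕ.≤ maxLoop →
    Triple totalGainT (splitInput e e′ xs ∷ []) (_≡ total (gain (raise e′)) xs)
  totalGain-triple e e′ xs xs≤ =
    recList-rule atomValue xs (λ xs v → v ≡ total (gain (raise e′)) xs) xs≤ exact exact
      λ { (w , X) xs refl →
      let-rule (call-rule exact λ { refl → raise-triple e′ X }) λ { refl →
      let-rule (oracle-triple X exact) λ { refl →
      let-rule (oracle-triple (raise e′ X) exact) λ { refl →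
      exact } } } }

  IsSplit : Literal u → Literal u → Weighted → Weighted → Set _
  IsSplit e e′ xs ys = ∃ λ r → Split (raise e) (raise e′) (- total (gain (raise e′)) xs) xs r ys

  split-triple : ∀ e e′ xs → length xs ℕ.≤ maxLoop →
    Triple splitT (splitInput e e′ xs ∷ []) (λ v → ∃ λ ys → v ≡ map atomValue ys × IsSplit e e′ xs ys)
  split-triple e e′ xs xs≤ =
    let-rule (call-rule exact λ { refl → totalGain-triple e e′ xs xs≤ }) λ { refl →
    prim-rule (weaken
      (recList-rule atomValue xs
        (λ xs′ v → ∃₂ λ r ys → v ≡ (r , map atomValue ys) × Split (raise e) (raise e′) r₀ xs′ r ys)
        xs≤ exact (pure (r₀ , [] , refl , done))
        λ { (w , X) xs (r , ys , refl , split) →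
        let-rule (call-rule exact λ { refl → raise-triple e X }) λ { refl →
        let-rule (call-rule exact λ { refl → raise-triple e′ X }) λ { refl →
        let-rule (oracle-triple X exact) λ { refl →
        let-rule (oracle-triple (raise e X) exact) λ { refl →
        let-rule (oracle-triple (raise e′ X) exact) λ { refl →
        let-rule exact λ { refl →
        if-rule (pure (proof (_ ≤? _)))
          (λ r+d≤0 → pure (_ , (w , raise e X) ∷ ys , refl , toU split r+d≤0)) λ r+d≰0 →
        if-rule (pure (proof (_ ≤? _)))
          (λ 0≤r → pure (_ , (w , raise e′ X) ∷ ys , refl , toV split 0≤r)) λ 0≰r →
        let-rule exact λ { refl →
        pure (_ , _ ∷ _ ∷ ys , refl , cut split r+d≰0 0≰r) } } } } } } } })
      λ { (r , ys , refl , split) → ys , refl , r , split }) }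
    where r₀ = - total (gain (raise e′)) xs

  indices-triple : Triple indicesT ((nats (lookup u) , map encode A) ∷ []) (_≡ nats toℕ)
  indices-triple = weaken
    (recList-rule-≤ (lift ∘ lookup u) (allFin n) (λ ks v → v ≡ map (lift ∘ toℕ) (allFin (length ks)))
      length-allFin-≤ exact exact λ { _ ks ks< refl →
      prim-rule (pair-rule exact λ { refl → weaken
        (map-triple (lift ∘ toℕ) (lift ∘ suc ∘ toℕ) (allFin (length ks))
          (ℕ.≤-trans (ℕ.≤-reflexive (length-allFin (length ks))) (ℕ.≤-trans (ℕ.<⇒≤ ks<) length-allFin-≤))
          exact (λ _ → exact))
        λ { refl → cong (lift 0 ∷_) (trans (List.map-tabulate (λ k → k) (lift ∘ suc ∘ toℕ))
                                           (sym (List.map-tabulate Fin.suc (lift ∘ toℕ)))) } }) })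
    λ { refl → cong (λ m → map (lift ∘ toℕ) (allFin m)) (length-allFin n) }

  rounds-triple : Triple roundsT ((nats (lookup u) , map encode A) ∷ []) (_≡ lift rounds)
  rounds-triple = recList-rule (lift ∘ lookup u) (allFin n) (λ ks v → v ≡ lift (sum (map (suc ∘ lookup u) ks)))
    length-allFin-≤ exact exact λ { _ _ refl → exact }

  literals-triple : Triple literalsT ((nats toℕ , nats (lookup u)) ∷ []) (_≡ map literalValue literals)
  literals-triple = recList-rule (lift ∘ toℕ) (allFin n) (λ is v → v ≡ map literalValue (literalsAt is))
    length-allFin-≤ exact exact λ { i is refl → weaken
    (recℕ-rule (λ m v → Σ[ m≤u ∈ m ℕ.≤ lookup u i ] v ≡ map literalValue (levels i m m≤u (literalsAt is)))
      (u≤maxLoop i) (lookup-triple (lift ∘ lookup u) i exact exact) (pure (z≤n , refl))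
      λ { m m<u (_ , refl) → pure (m<u , refl) })
    λ { (_ , refl) → refl } }
    where
    u≤maxLoop : ∀ i → lookup u i ℕ.≤ maxLoop
    u≤maxLoop i = ℕ.≤-trans (ℕ.n≤1+n _) (ℕ.≤-trans (term (∈-allFin i)) rounds≤maxLoop)
      where
      term : ∀ {is} → i ∈ is → suc (lookup u i) ℕ.≤ sum (map (suc ∘ lookup u) is)
      term (here refl)  = ℕ.m≤m+n _ _
      term (there i∈is) = ℕ.m≤n⇒m≤o+n _ (term i∈is)

  L : ℕ
  L = length (literals {u = u})

  1+L²≤maxLoop : 1 ℕ.+ L ℕ.* L ℕ.≤ maxLoop
  1+L²≤maxLoop = ℕ.+-mono-≤
    (ℕ.≤-trans (s≤s z≤n) (ℕ.m≤m+n (1 ℕ.+ length A) K)) (ℕ.*-mono-≤ L≤K L≤K)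
    where
    K = n ℕ.* (1 ℕ.+ U)
    L≤K : L ℕ.≤ K
    L≤K = begin
      L                                      ≡⟨ length-literalsAt (allFin n) ⟩
      sum (map (lookup u) (allFin n))        ≤⟨ sum-mono-≤ (λ k → ℕ.n≤1+n (lookup u k)) (allFin n) ⟩
      rounds                                 ≤⟨ rounds≤ ⟩
      K                                      ∎
      where open ℕ.≤-Reasoning

  L≤maxLoop : L ℕ.≤ maxLoop
  L≤maxLoop = ℕ.≤-trans (square L) 1+L²≤maxLoop
    where
    square : ∀ m → m ℕ.≤ 1 ℕ.+ m ℕ.* m
    square zero    = z≤n
    square (suc m) = ℕ.m≤n⇒m≤1+n (ℕ.m≤m+n (suc m) _)

  clauseCap : Literal u → Literal u → Point n
  clauseCap e e′ = capPoint e′ (capPoint e (lookup u))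

  clauseCap≤u : ∀ e e′ → clauseCap e e′ ≤̇ lookup u
  clauseCap≤u e e′ k = ℕ.≤-trans (capPoint-≤ e′ (capPoint e (lookup u)) k) (capPoint-≤ e (lookup u) k)

  -- That is, the clause x ⊨ e ∨ x ⊨ e′ holds for every feasible x.
  Implied : Literal u → Literal u → Set _
  Implied e e′ = ¬ FeasBelow (clauseCap e e′)

  implied-sound : ∀ {e e′ s} → Implied e e′ → s ≤̇ lookup u → Feas s → s ⊨ e ⊎ s ⊨ e′
  implied-sound {e} {e′} {s} implied s≤u feas with level e ℕ.<? s (coord e) | level e′ ℕ.<? s (coord e′)
  ... | yes s⊨e | _         = inj₁ s⊨e
  ... | no  _   | yes s⊨e′  = inj₂ s⊨e′
  ... | no  s⊭e | no  s⊭e′  = contradiction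
    (s , feas , capPoint-glb e′ (capPoint-glb e s≤u (ℕ.≮⇒≥ s⊭e)) (ℕ.≮⇒≥ s⊭e′)) implied

  Covers : Literal u → Literal u → MultiSet u → Set _
  Covers e e′ X = Implied e e′ → toPoint X ⊨ e ⊎ toPoint X ⊨ e′

  -- Sets are only ever raised, so properties of this kind survive the treatment of later clauses.
  UpwardClosed : ∀ {p} → (MultiSet u → Set p) → Set p
  UpwardClosed Q = ∀ {X Y} → X ⊆ Y → Q X → Q Y

  ⊨-upwardClosed : (e : Literal u) → UpwardClosed (λ X → toPoint {u = u} X ⊨ e)
  ⊨-upwardClosed e {X} {Y} X⊆Y X⊨e = ℕ.≤-trans X⊨e (⊆-toPoints {X = X} {Y} X⊆Y (coord e))

  covers-upwardClosed : ∀ e e′ → UpwardClosed (Covers e e′)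
  covers-upwardClosed e e′ {X} {Y} X⊆Y covers implied with covers implied
  ... | inj₁ X⊨e  = inj₁ (⊨-upwardClosed e {X} {Y} X⊆Y X⊨e)
  ... | inj₂ X⊨e′ = inj₂ (⊨-upwardClosed e′ {X} {Y} X⊆Y X⊨e′)

  -- The loop invariant of `coverT`: a probability distribution, with `k` one more than the number
  -- of clauses treated. The field `cheap` quantifies over all feasible `S` because the optimum is
  -- unknown.
  record Cover {p} (Q : MultiSet u → Set p) (k : ℕ) (xs : Weighted) : Set (c ⊔ ℓ₁ ⊔ ℓ₂ ⊔ p) where
    field
      nonneg  : Nonneg xs
      weight  : total (λ _ → 1#) xs ≈ 1#
      cheap   : ∀ S → Feas (toPoint S) → total (potential S) xs ≤ f S + f S
      covered : All (λ (_ , X) → Q X) xs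
      short   : length xs ℕ.≤ k

  open Cover

  cover-map : ∀ {p q} {Q : MultiSet u → Set p} {R : MultiSet u → Set q} {k l xs} →
              (∀ {X} → Q X → R X) → k ≡ l → Cover Q k xs → Cover R l xs
  cover-map Q⇒R refl cov = record
    { nonneg = nonneg cov ; weight = weight cov ; cheap = cheap cov
    ; covered = All.map Q⇒R (covered cov) ; short = short cov }

  cover-split : ∀ {p} {Q : MultiSet u → Set p} {k xs ys} e e′ → UpwardClosed Q → Implied e e′ →
                Cover Q k xs → IsSplit e e′ xs ys → Cover (λ X → Covers e e′ X × Q X) (suc k) ys
  cover-split {Q = Q} {k} {xs} {ys} e e′ up implied cov (r , split) = record
    { nonneg  = split-nonneg (raise e) (raise e′) (gain-nonneg e) (gain-nonneg e′) split (nonneg cov)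
    ; weight  = ≈-trans (total-split-weight (raise e) (raise e′) (λ _ → 1#) (λ _ → ≈-refl) (λ _ → ≈-refl) split) (weight cov)
    ; cheap   = λ S feas → ≤-trans
        (split-potential e e′ (nonneg cov) split {S} (implied-sound {e} {e′} implied (toPoint-≤ S) feas)) (cheap cov S feas)
    ; covered = split-all (raise e) (raise e′)
        (λ {X} q → (λ _ → inj₁ (raise-⊨ e X)) , up {X} {raise e X} (raise-inflationary e X) q)
        (λ {X} q → (λ _ → inj₂ (raise-⊨ e′ X)) , up {X} {raise e′ X} (raise-inflationary e′ X) q)
        split (covered cov)
    ; short   = ℕ.≤-trans (proj₁ (split-length (raise e) (raise e′) (gain-nonneg e) (gain-nonneg e′) (nonneg cov) split))
                          (s≤s (short cov))
    }

  Atoms : ∀ {p} (Q : MultiSet u → Set p) (k : ℕ) → Val (list atom) → Set _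
  Atoms Q k v = ∃ λ xs → v ≡ map atomValue xs × Cover Q k xs

  globalValue : Val globals
  globalValue = nats toℕ , lift rounds , map literalValue literals , nats (lookup u) , map encode A

  clause-triple : ∀ {p} {Q : MultiSet u → Set p} {k xs} e e′ → UpwardClosed Q → k ℕ.≤ maxLoop → Cover Q k xs →
    Triple clauseT ((globalValue , literalValue e , literalValue e′ , map atomValue xs) ∷ [])
                   (Atoms (λ X → Covers e e′ X × Q X) (suc k))
  clause-triple {xs = xs} e e′ up k≤ cov =
    let-rule exact λ { refl →
    let-rule exact λ { refl →
    let-rule (call-rule exact λ { refl → capPoint-triple e (lookup u) }) λ { refl →
    let-rule (call-rule exact λ { refl → capPoint-triple e′ (capPoint e (lookup u)) }) λ { refl →
    if-rule (call-rule exact λ { refl → feasibleBelow-triple feasiblePoint (clauseCap e e′) (clauseCap≤u e e′) })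
      (λ below → pure (xs , refl , record
        { nonneg = nonneg cov ; weight = weight cov ; cheap = cheap cov
        ; covered = All.map (λ q → (λ implied → contradiction below implied) , q) (covered cov)
        ; short = ℕ.m≤n⇒m≤1+n (short cov) }))
      (λ implied → call-rule exact λ { refl →
        weaken (split-triple e e′ xs (ℕ.≤-trans (short cov) k≤))
          λ { (ys , refl , split) → ys , refl , cover-split e e′ up implied cov split } }) } } } }

  CoversAll : List (Literal u) → MultiSet u → Set _
  CoversAll es X = All (λ e → All (λ e′ → Covers e e′ X) literals) es

  coversAll-upwardClosed : ∀ es → UpwardClosed (CoversAll es)
  coversAll-upwardClosed es {X} {Y} X⊆Y =
    All.map (λ {e} → All.map (λ {e′} → covers-upwardClosed e e′ {X} {Y} X⊆Y))

  -- The weight is written `fromℕ 1`, as this is what `numeral 1` evaluates to.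
  cover-∅ : Cover (CoversAll []) 1 ((fromℕ 1 , ∅) ∷ [])
  cover-∅ = record
    { nonneg  = 0≤fromℕ 1 ∷ []
    ; weight  = one 1#
    ; cheap   = λ S feas → ≤-respˡ-≈ (≈-sym (one _))
        (potential-≤ {S} {∅} (nonnegative ∅)
          (⊆-fromPoints {X = ∅} {S} (λ k → ℕ.≤-trans (ℕ.≤-reflexive (Vec.lookup∘tabulate (λ _ → 0) k)) z≤n)))
    ; covered = [] ∷ []
    ; short   = s≤s z≤n
    }
    where
    one : ∀ x → 0# + fromℕ 1 * x ≈ x
    one x = ≈-trans (+-identityˡ _) (≈-trans (*-congʳ (+-identityʳ 1#)) (*-identityˡ x))

  cover-triple : Triple coverT (globalValue ∷ []) (Atoms (CoversAll literals) (1 ℕ.+ L ℕ.* L))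
  cover-triple =
    let-rule (map-triple (lift ∘ toℕ) (λ _ → lift 0) (allFin n) length-allFin-≤ exact (λ _ → exact)) λ { refl →
    recList-rule-≤ literalValue literals (λ es → Atoms (CoversAll es) (1 ℕ.+ length es ℕ.* L)) L≤maxLoop exact
      (pure ((fromℕ 1 , ∅) ∷ [] , cong (λ s → (fromℕ 1 , s) ∷ [])
              (nats-cong (sym ∘ Vec.lookup∘tabulate (λ _ → 0))) , cover-∅))
      λ { e es es< (xs , refl , cov) → weaken
        (recList-rule-≤ literalValue literals
          (λ es′ → Atoms (λ X → All (λ e′ → Covers e e′ X) es′ × CoversAll es X) (length es′ ℕ.+ (1 ℕ.+ length es ℕ.* L)))
          L≤maxLoop exact (pure (xs , refl , cover-map ([] ,_) refl cov))
          λ { e′ es′ es′< (ys , refl , cov) →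
            call-rule exact λ { refl → weaken
              (clause-triple e e′
                (λ {X} {Y} X⊆Y (p , q) → All.map (λ {e′} → covers-upwardClosed e e′ {X} {Y} X⊆Y) p ,
                                         coversAll-upwardClosed es {X} {Y} X⊆Y q)
                (bound es< es′<) cov)
              λ { (zs , refl , cov) → zs , refl , cover-map (λ (p , ps , q) → p ∷ ps , q) refl cov } } })
        λ { (ys , refl , cov) → ys , refl , cover-map (λ (p , q) → p ∷ q) (ℕ.+-suc L (length es ℕ.* L)) cov } } }
    where
    bound : ∀ {k l} → suc k ℕ.≤ L → suc l ℕ.≤ L → l ℕ.+ (1 ℕ.+ k ℕ.* L) ℕ.≤ maxLoop
    bound {k} {l} k<L l<L = begin
      l ℕ.+ (1 ℕ.+ k ℕ.* L)   ≡⟨ ℕ.+-suc l (k ℕ.* L) ⟩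
      1 ℕ.+ (l ℕ.+ k ℕ.* L)   ≤⟨ s≤s (ℕ.+-monoˡ-≤ (k ℕ.* L) (ℕ.<⇒≤ l<L)) ⟩
      1 ℕ.+ suc k ℕ.* L       ≤⟨ s≤s (ℕ.*-monoˡ-≤ L k<L) ⟩
      1 ℕ.+ L ℕ.* L           ≤⟨ 1+L²≤maxLoop ⟩
      maxLoop                 ∎
      where open ℕ.≤-Reasoning

  coversAll-full : ∀ es → CoversAll es full
  coversAll-full es = All.universal (λ e → All.universal (λ { e′ _ → inj₁ (full-⊨ e) }) literals) es
    where
    full-⊨ : (e : Literal u) → toPoint (full {u = u}) ⊨ e
    full-⊨ (literal i p p<u) = subst (p ℕ.<_) (sym (Vec.lookup∘tabulate (lookup u) i))
                                     (recompute (p ℕ.<? lookup u i) p<u)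

  -- The covering property is stated as an implication, so that `cheapestT` can be specified for an
  -- arbitrary family.
  Chosen : Weighted → MultiSet u → Set _
  Chosen xs X = (All (λ (_ , Y) → CoversAll literals Y) xs → CoversAll literals X) × All (λ (_ , Y) → f X ≤ f Y) xs

  cheapest-triple : ∀ xs → length xs ℕ.≤ maxLoop →
    Triple cheapestT ((nats (lookup u) , map atomValue xs) ∷ []) (λ v → ∃ λ X → v ≡ nats (toPoint X) × Chosen xs X)
  cheapest-triple xs xs≤ =
    recList-rule atomValue xs (λ xs v → ∃ λ X → v ≡ nats (toPoint X) × Chosen xs X) xs≤ exact
      (pure (full , nats-cong (sym ∘ Vec.lookup∘tabulate (lookup u)) ,
             (λ _ → coversAll-full literals) , []))
      λ { (w , Y) ys (X , refl , covers , X≤) →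
      let-rule (oracle-triple Y exact) λ { refl →
      let-rule (oracle-triple X exact) λ { refl →
      if-rule (pure (proof (_ ≤? _)))
        (λ Y≤X → pure (Y , refl , All.head , ≤-refl ∷ All.map (≤-trans Y≤X) X≤))
        (λ Y≰X → pure (X , refl , covers ∘ All.tail , ≰⇒≥ Y≰X ∷ X≤)) } } }

  -- The multi-set violates the literals whose levels are its own entries at `k` and `l`. Since it
  -- satisfies all implied clauses, this clause is not implied, and deciding feasibility yields a
  -- feasible point within both bounds. `helly` combines these points.
  coversAll⇒feasBelow : ∀ X → CoversAll literals X → FeasBelow (toPoint X)
  coversAll⇒feasBelow X covers = helly x feasiblePoint pair-below
    where
    x = toPoint X
    BelowAt : Fin n → Fin n → Set _
    BelowAt k l = ∃ λ s → Feas s × s ≤̇ lookup u × s k ℕ.≤ x k × s l ℕ.≤ x l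
    clause-below : ∀ k l → x k ℕ.< lookup u k → x l ℕ.< lookup u l → BelowAt k l
    clause-below k l k<u l<u
      with feasBelow? feasiblePoint (clauseCap (literal k (x k) k<u) (literal l (x l) l<u))
    ... | yes (s , feas , s≤) =
      s , feas , (λ j → ℕ.≤-trans (s≤ j) (clauseCap≤u e e′ j)) ,
      ℕ.≤-trans (s≤ k) (ℕ.≤-trans (capPoint-≤ e′ (capPoint e (lookup u)) k) (capPoint-⊭ e (lookup u))) ,
      ℕ.≤-trans (s≤ l) (capPoint-⊭ e′ (capPoint e (lookup u)))
      where
      e e′ : Literal u
      e  = literal k (x k) k<u
      e′ = literal l (x l) l<u
    ... | no implied with All.lookup (All.lookup covers (∈-literals k<u)) (∈-literals l<u) implied
    ...   | inj₁ x<x = contradiction x<x (ℕ.<-irrefl refl)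
    ...   | inj₂ x<x = contradiction x<x (ℕ.<-irrefl refl)
    pair-below : ∀ k l → ∃ λ s → Feas s × s k ℕ.≤ x k × s l ℕ.≤ x l
    pair-below k l with x k ℕ.<? lookup u k | x l ℕ.<? lookup u l
    ... | yes k<u | yes l<u =
      let (s , feas , _ , sk≤ , sl≤) = clause-below k l k<u l<u in s , feas , sk≤ , sl≤
    -- There is no literal at the level `u` itself, but there the bound holds for every multi-set.
    -- The clause that repeats the other literal is enough.
    ... | yes k<u | no  l≮u =
      let (s , feas , s≤u , sk≤ , _) = clause-below k k k<u k<u in s , feas , sk≤ , ℕ.≤-trans (s≤u l) (ℕ.≮⇒≥ l≮u)
    ... | no  k≮u | yes l<u =
      let (s , feas , s≤u , sl≤ , _) = clause-below l l l<u l<u in s , feas , ℕ.≤-trans (s≤u k) (ℕ.≮⇒≥ k≮u) , sl≤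
    ... | no  k≮u | no  l≮u =
      let (s , feas) = feasiblePoint
          s≤u        = toPoint-≤ {u = u} (proj₁ feasible)
      in s , feas , ℕ.≤-trans (s≤u k) (ℕ.≮⇒≥ k≮u) , ℕ.≤-trans (s≤u l) (ℕ.≮⇒≥ l≮u)

  -- Lowering a covering multi-set to a feasible point.

  MinimalAt : Point n → Literal u → Set _
  MinimalAt h e = ∀ s → Feas s → s ≤̇ h → s (coord e) ℕ.≤ level e → h (coord e) ℕ.≤ level e

  record Reduced (x : Point n) (es : List (Literal u)) (h : Point n) : Set (c ⊔ ℓ₂) where
    field
      h≤x       : h ≤̇ x
      feasBelow : FeasBelow h
      minimal   : All (MinimalAt h) es

  open Reduced

  -- The reason why a single pass of `minimiseT` suffices: a smaller bound has fewer feasible points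
  -- below it.
  minimalAt-mono : ∀ {h h′ e} → h′ ≤̇ h → MinimalAt h e → MinimalAt h′ e
  minimalAt-mono {e = e} h′≤h min s feas s≤h′ s≤e =
    ℕ.≤-trans (h′≤h (coord e)) (min s feas (λ k → ℕ.≤-trans (s≤h′ k) (h′≤h k)) s≤e)

  minimise-triple : ∀ {x} → x ≤̇ lookup u → FeasBelow x →
    Triple minimiseT ((globalValue , nats x) ∷ []) (λ v → ∃ λ h → v ≡ nats h × Reduced x literals h)
  minimise-triple {x} x≤u below =
    recList-rule literalValue literals (λ es v → ∃ λ h → v ≡ nats h × Reduced x es h) L≤maxLoop exact
      (pure (x , refl , record { h≤x = λ _ → ℕ.≤-refl ; feasBelow = below ; minimal = [] }))
      λ { e es (h , refl , red) →
      let-rule exact λ { refl →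
      let-rule (call-rule exact λ { refl → capPoint-triple e h }) λ { refl →
      if-rule (call-rule exact λ { refl → feasibleBelow-triple feasiblePoint (capPoint e h)
                 (λ k → ℕ.≤-trans (capPoint-≤ e h k) (ℕ.≤-trans (h≤x red k) (x≤u k))) })
        (λ below → pure (capPoint e h , refl , record
          { h≤x       = λ k → ℕ.≤-trans (capPoint-≤ e h k) (h≤x red k)
          ; feasBelow = below
          ; minimal   = (λ _ _ _ _ → capPoint-⊭ e h) ∷ All.map (λ {e′} → minimalAt-mono {e = e′} (capPoint-≤ e h)) (minimal red) }))
        (λ ¬below → pure (h , refl , record
          { h≤x       = h≤x red
          ; feasBelow = feasBelow red
          ; minimal   = (λ s feas s≤h s≤e → contradiction (s , feas , capPoint-glb e s≤h s≤e) ¬below) ∷ minimal red })) } } }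

  -- A feasible point below a minimal bound h cannot be smaller than h.
  reduced⇒feas : ∀ {x h} → x ≤̇ lookup u → Reduced x literals h → Feas h
  reduced⇒feas {x} {h} x≤u red with feasBelow red
  ... | s , feas , s≤h = All.map (λ {C} → subst₂ (At C) (s≡h (i C)) (s≡h (j C))) feas
    where
    s≡h : ∀ k → s k ≡ h k
    s≡h k with s k ℕ.<? h k
    ... | no  s≮h = ℕ.≤-antisym (s≤h k) (ℕ.≮⇒≥ s≮h)
    ... | yes s<h = contradiction
      (All.lookup (minimal red) (∈-literals (ℕ.<-≤-trans s<h (ℕ.≤-trans (h≤x red k) (x≤u k)))) s feas s≤h ℕ.≤-refl)
      (ℕ.<⇒≱ s<h)

  -- A minimum is at most the average, since the weights sum to one, and the average of `f` is at
  -- most that of the potential.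
  chosen-cheap : ∀ {xs X} → Cover (CoversAll literals) (1 ℕ.+ L ℕ.* L) xs → Chosen xs X →
                 ∀ S → Feas (toPoint S) → f X ≤ f S + f S
  chosen-cheap {xs} {X} cov (_ , X≤) S feas =
    ≤-trans (≤-reflexive (≈-trans (≈-sym (*-identityˡ (f X)))
              (≈-trans (*-congʳ (≈-sym (weight cov))) (≈-sym (total-const (f X) xs)))))
    (≤-trans (total-mono-≤ (nonneg cov) (All.map (λ {(_ , Y)} X≤Y → ≤-trans X≤Y (fX≤potential S Y)) X≤))
             (cheap cov S feas))

  IsApproximation : Val (list nat) → Set _
  IsApproximation v = Σ[ X ∈ MultiSet u ] v ≡ nats (toPoint X) × Feas (toPoint X) ×
                      (∀ S → Feas (toPoint S) → f X ≤ f S + f S)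

  Correct : Algorithm → Set _
  Correct alg = Triple alg ((nats (lookup u) , map encode A) ∷ []) IsApproximation

  algorithm-triple : Correct algorithm
  algorithm-triple =
    let-rule (call-rule exact λ { refl → indices-triple }) λ { refl →
    let-rule (call-rule exact λ { refl → rounds-triple }) λ { refl →
    let-rule (call-rule exact λ { refl → literals-triple }) λ { refl →
    let-rule exact λ { refl →
    let-rule (call-rule exact λ { refl → cover-triple }) λ { (xs , refl , cov) →
    let-rule (call-rule exact λ { refl → cheapest-triple xs (ℕ.≤-trans (short cov) 1+L²≤maxLoop) }) λ { (X , refl , chosen) →
    call-rule exact λ { refl →
    weaken (minimise-triple (toPoint-≤ X) (coversAll⇒feasBelow X (proj₁ chosen (covered cov))))
      λ { (h , refl , red) →
        let h≤u : h ≤̇ lookup u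
            h≤u k = ℕ.≤-trans (h≤x red k) (toPoint-≤ X k)
            Y : MultiSet u
            Y   = fromPoint h h≤u
            Y≗h : toPoint Y ≗ h
            Y≗h = toPoint∘fromPoint {u = u} h h≤u
        in Y , nats-cong (sym ∘ Y≗h) ,
           All.map (λ {C} → subst₂ (At C) (sym (Y≗h (i C))) (sym (Y≗h (j C)))) (reduced⇒feas (toPoint-≤ X) red) ,
           λ S feas → ≤-trans
             (monotone Y X (⊆-fromPoints {X = Y} {X} (λ k → ℕ.≤-trans (ℕ.≤-reflexive (Y≗h k)) (h≤x red k))))
             (chosen-cheap cov chosen S feas) } } } } } } } }

  fromℕ-2-* : ∀ x → fromℕ 2 * x ≈ x + x
  fromℕ-2-* x = ≈-trans (*-congʳ (+-congˡ (+-identityʳ 1#)))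
    (≈-trans (solve 2 (λ o x → (o :+ o) :* x := o :* x :+ o :* x) ≈-refl 1# x)
             (+-cong (*-identityˡ x) (*-identityˡ x)))
    where open Solver

  approximation : (alg : Algorithm) → Correct alg →
    (Σ[ X ∈ MultiSet u ] output alg P ≡ toList (mult X) × Feasible X ×
                         (∀ S* → Optimal S* → f X ≤ fromℕ 2 * f S*)) ×
    time alg P ℕ.≤ +-*-Solver.⟦ cost alg ⟧ (n ∷ length A ∷ U ∷ [])
  approximation alg tr =
    let (X , output≡ , feas , cheap) = post run-triple
    in (X , trans (cong (map lower) output≡) (lower-nats X) , feas ,
        λ S* (S*-feas , _) → ≤-respʳ-≈ (≈-sym (fromℕ-2-* (f S*))) (cheap S* S*-feas)) ,
       fast run-triple
    where
    run-triple : Triple alg (input alg P ∷ []) IsApproximation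
    run-triple = subst (λ us → Triple alg ((us , map encode A) ∷ []) IsApproximation)
                       (trans (List.map-∘ (allFin n)) (cong (map lift) (toList-array u))) tr

-- The algorithm is hidden in an existential so that the type checker cannot
-- evaluate it when comparing statements about its output.
algorithm-correct : ∀ {c ℓ₁ ℓ₂} (ℝ : RealField c ℓ₁ ℓ₂) → let open Problem ℝ; open SM2Multi in
  ∃ λ alg → ∀ {n} (P : SM2Multi n) (feasible : ∃ (Feasible P)) (nonnegative : Nonnegative (f P))
              (submodular : Submodular (f P)) (monotone : Monotone (f P)) →
    Approximation.Correct ℝ P feasible nonnegative submodular monotone alg
algorithm-correct ℝ = algorithm , Approximation.algorithm-triple ℝ

open import Data.Nat.Base using (_≤_)

mainTheorem3 : ∀ {c ℓ₁ ℓ₂} (ℝ : RealField c ℓ₁ ℓ₂) →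
    let open RealField ℝ using (fromℕ) renaming (_≤_ to _≤ᴿ_)
        open RealField ℝ using (_*_)
        open Problem ℝ
        open SM2Multi
        open Semantics ℝ
    in
    Σ[ alg ∈ Algorithm ] Σ[ p ∈ +-*-Solver.Polynomial 3 ]
      ∀ (n : ℕ) (P : SM2Multi n) →
        ∃ (Feasible P) → Nonnegative (f P) → Submodular (f P) → Monotone (f P) →
        (Σ[ X ∈ MultiSet (u P) ]
            output alg P ≡ toList (mult X)
          × Feasible P X
          × (∀ S* → Optimal P S* → f P X ≤ᴿ fromℕ 2 * f P S*))
        × time alg P ≤ +-*-Solver.⟦ p ⟧ (n ∷ length (A P) ∷ U P ∷ [])
mainTheorem3 ℝ = case algorithm-correct ℝ of λ (alg , correct) →
  alg , cost alg , λ n P feasible nonnegative submodular monotone →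
  Approximation.approximation ℝ P feasible nonnegative submodular monotone alg
    (correct P feasible nonnegative submodular monotone)
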